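{- Every simple edge-coloured graph with $n$ vertices and $n$ colours, in which each colour class has size at least $3$, contains a rainbow cycle of length at most $\frac{4n}{9} + 7$.
   Context: Graphs may have parallel edges. An edge-coloured graph is simple if no colour class contains two parallel edges (edges of different colours may be parallel); two parallel edges form a cycle of length 2. A subgraph is rainbow if no two of its edges have the same colour. -}

module Defs where

open import Data.Nat using (ℕ; zero; suc; _+_; _*_; _≤_; _%_)
open import Data.Nat.DivMod using (m%n<n)
open import Data.Fin using (Fin; toℕ; fromℕ<; zero; suc; _≟_)
open import Data.List using (length; filter; allFin)
open import Data.Product using (_×_; _,_; Σ; proj₁; proj₂)
open import Data.Sum using (_⊎_)
open import Function.Definitions using (Injective)
open import Relation.Binary.PropositionalEquality using (_≡_; _≢_)
open import Relation.Nullary using (¬_)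

-- An edge-coloured multigraph on vertex set Fin n with colour set Fin n.
-- It has m edges (indexed by Fin m); parallel edges are allowed, loops are not.
record ColouredGraph (n : ℕ) : Set where
  field
    m        : ℕ
    endpoint : Fin m → Fin n × Fin n
    colour   : Fin m → Fin n
    noLoops  : ∀ e → proj₁ (endpoint e) ≢ proj₂ (endpoint e)
open ColouredGraph public

Joins : ∀ {n} (G : ColouredGraph n) → Fin (m G) → Fin n → Fin n → Set
Joins G e u v =
  (proj₁ (endpoint G e) ≡ u × proj₂ (endpoint G e) ≡ v)
  ⊎ (proj₁ (endpoint G e) ≡ v × proj₂ (endpoint G e) ≡ u)

Simple : ∀ {n} → ColouredGraph n → Set
Simple {n} G = ∀ (e f : Fin (m G)) → e ≢ f → colour G e ≡ colour G f →
  ¬ (Joins G f (proj₁ (endpoint G e)) (proj₂ (endpoint G e)))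

classSize : ∀ {n} → ColouredGraph n → Fin n → ℕ
classSize G c = length (filter (λ e → colour G e ≟ c) (allFin (m G)))

next : ∀ {k} → Fin (suc k) → Fin (suc k)
next {k} i = fromℕ< (m%n<n (suc (toℕ i)) (suc k))

-- A rainbow cycle of length suc (suc k) (so length ≥ 2): distinct vertices
-- v_0 … v_{ℓ-1}, edges e_i joining v_i and v_{i+1 mod ℓ}, with pairwise
-- distinct colours (hence pairwise distinct edges).
record RainbowCycle {n} (G : ColouredGraph n) (k : ℕ) : Set where
  field
    vertex      : Fin (suc (suc k)) → Fin n
    edge        : Fin (suc (suc k)) → Fin (m G)
    vertexInj   : Injective _≡_ _≡_ vertex
    joins       : ∀ i → Joins G (edge i) (vertex i) (vertex (next i))
    rainbow     : Injective _≡_ _≡_ (λ i → colour G (edge i))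

cycleLength : ℕ → ℕ
cycleLength k = suc (suc k)

-- Suppose every rainbow cycle has length at least g > (4n + 63) / 9. A colour is alive in a vertex set W if
-- it has an edge inside W; one edge of each alive colour gives a rainbow graph on W. Repeatedly deleting or
-- suppressing vertices of degree at most two shows that a graph of girth g with |W| + k edges has at least
-- g, 3g/2, 2g, 9g/4 edges for k = 0, 1, 2, 3, and as only n colours exist no W has excess 3. Given a minimal
-- W of excess 2, or else of excess 1, few colours have two edges inside W, so almost every colour still has
-- two edges not inside W. The graph of those edges has its own short rainbow cycles, and they have to lie
-- mostly outside W, where there is too little room. Finally, if no W has positive excess, every vertex v has
-- a colour of its own all of whose edges meet v. The other ends of these edges are three out-neighbours of v
-- in a digraph on n vertices whose directed cycles are rainbow, and growing balls finds a short closed set.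
module Submission where

-- The constant 4/9 comes from three cases that all balance at n ≥ 9g/4. Excess three gives this at
-- once. Excess one gives it twice, as 3g/2 vertices in W plus 3g/4 outside: first as half of a
-- second set with 3g/2 vertices, then as the set of forced stops in a digraph of outdegree two.
-- Every other case leaves a positive fraction of n to spare (excess two reaches 5g/2, the digraph
-- of outdegree three at least 7g/3), so additive constants can be treated generously.
--
-- No directed cycle is ever extracted from a digraph. Its role is taken by a closed set, in which
-- every vertex has an out-neighbour in the set. When each vertex owns a colour, a closed set has at
-- least as many alive colours as vertices, so the excess-zero bound already gives it g vertices.
-- Closed sets are also easier to glue together, to shrink and to minimise than walks.

open import Defs

open import Data.Bool.Base using (Bool; true; false; if_then_else_; _∧_; _∨_; not)
open import Data.Empty using (⊥; ⊥-elim)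
open import Data.Fin.Base using (Fin; zero; suc; toℕ; fromℕ<; inject≤)
open import Data.Fin.Properties as Fin using (_≟_; toℕ<n; toℕ-fromℕ<; toℕ-injective; inject≤-injective)
open import Data.List.Base as List using (List; []; _∷_; _++_; length; [_]; take; filter; allFin)
open import Data.List.Membership.Propositional.Properties using (∈-lookup; ∈-filter⁻)
open import Data.List.Properties using (length-++; length-take)
open import Data.List.Relation.Binary.Permutation.Propositional as Perm using (_↭_; ↭-refl; ↭-prep; ↭-swap; ↭-trans; ↭-sym)
open import Data.List.Relation.Binary.Permutation.Propositional.Properties using (All-resp-↭; ↭-length) renaming (shift to ↭-shift)
open import Data.List.Relation.Unary.All as ListAll using (All)
open import Data.List.Relation.Unary.All.Properties using (++⁻ˡ; ++⁻ʳ; take⁺)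
open import Data.List.Relation.Unary.AllPairs as AllPairs using ()
open import Data.List.Relation.Unary.Unique.Propositional using (Unique)
open import Data.List.Relation.Unary.Unique.Propositional.Properties using (allFin⁺; filter⁺)
open import Data.Nat.Base
open import Data.Nat.DivMod using (m<n⇒m%n≡m; n%n≡0; m%n<n; m≡m%n+[m/n]*n; m<n*o⇒m/o<n)
open import Data.Nat.Properties hiding (_≟_)
open import Data.Nat.Tactic.RingSolver using (solve; solve-∀)
open import Data.Product.Base using (Σ; ∃; _×_; _,_; proj₁; proj₂)
open import Data.Sum.Base using (_⊎_; inj₁; inj₂)
open import Data.Vec.Base as Vec using (Vec; lookup; tabulate)
open import Data.Vec.Properties using (lookup∘tabulate)
open import Function.Base using (_∘_; id; case_of_)
open import Relation.Binary.Definitions using (tri<; tri≈; tri>)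
open import Relation.Binary.PropositionalEquality hiding ([_])
open import Relation.Nullary
open import Relation.Nullary.Decidable using (dec-true; dec-false; decidable-stable; map′; _×-dec_; _⊎-dec_; _→-dec_; ¬?)
open import Algebra.Properties.CommutativeMonoid.Sum +-0-commutativeMonoid using (sum; sum-cong-≗; ∑-distrib-+; ∑-comm)
open import Algebra.Properties.Semiring.Sum +-*-semiring using (*-distribˡ-sum; *-distribʳ-sum)

-- A linear consequence c ≤ d of X ≤ Y, certified by a semiring identity.
linear : ∀ {c d X Y} s → X ≤ Y → d + X ≡ c + s + Y → c ≤ d
linear {c} {d} {X} {Y} s X≤Y eq = +-cancelʳ-≤ X c d (begin
  c + X     ≤⟨ +-monoʳ-≤ c X≤Y ⟩
  c + Y     ≤⟨ +-monoˡ-≤ Y (m≤m+n c s) ⟩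
  c + s + Y ≡⟨ sym eq ⟩
  d + X     ∎)
  where open ≤-Reasoning

infixl 6 _⊕_
infixl 7 _⊛_
_⊕_ : ∀ {a b c d} → a ≤ b → c ≤ d → a + c ≤ b + d
_⊕_ = +-mono-≤
_⊛_ : ∀ k {a b} → a ≤ b → k * a ≤ k * b
k ⊛ p = *-monoʳ-≤ k p

-- Finite sums and indicators

sum-mono : ∀ {n} {f g : Fin n → ℕ} → (∀ i → f i ≤ g i) → sum f ≤ sum g
sum-mono {zero}  f≤g = z≤n
sum-mono {suc n} f≤g = f≤g zero ⊕ sum-mono (f≤g ∘ suc)

sum-const : ∀ n c → sum {n} (λ _ → c) ≡ n * c
sum-const zero    c = refl
sum-const (suc n) c = cong (c +_) (sum-const n c)

term≤sum : ∀ {n} (f : Fin n → ℕ) i → f i ≤ sum f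
term≤sum f zero    = m≤m+n _ _
term≤sum f (suc i) = ≤-trans (term≤sum (f ∘ suc) i) (m≤n+m _ (f zero))

sum-+-mono : ∀ {n} {f g h : Fin n → ℕ} → (∀ i → f i ≤ g i + h i) → sum f ≤ sum g + sum h
sum-+-mono {g = g} {h} f≤g+h = ≤-trans (sum-mono f≤g+h) (≤-reflexive (∑-distrib-+ g h))

χ : Bool → ℕ
χ b = if b then 1 else 0

χ≤1 : ∀ b → χ b ≤ 1
χ≤1 true  = ≤-refl
χ≤1 false = z≤n

⟦_⟧ : ∀ {p} {P : Set p} → Dec P → ℕ
⟦ P? ⟧ = χ (does P?)

does⇒ : ∀ {p} {P : Set p} (P? : Dec P) → does P? ≡ true → P
does⇒ (yes p) _ = p

⟦⟧-yes : ∀ {p} {P : Set p} (P? : Dec P) → P → ⟦ P? ⟧ ≡ 1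
⟦⟧-yes (yes _) p = refl
⟦⟧-yes (no ¬p) p = ⊥-elim (¬p p)

⟦⟧-no : ∀ {p} {P : Set p} (P? : Dec P) → ¬ P → ⟦ P? ⟧ ≡ 0
⟦⟧-no (yes p) ¬p = ⊥-elim (¬p p)
⟦⟧-no (no _)  ¬p = refl

⟦⟧-mono : ∀ {p q} {P : Set p} {Q : Set q} (P? : Dec P) (Q? : Dec Q) → (P → Q) → ⟦ P? ⟧ ≤ ⟦ Q? ⟧
⟦⟧-mono (no _)  Q? P⇒Q = z≤n
⟦⟧-mono (yes p) Q? P⇒Q = ≤-reflexive (sym (⟦⟧-yes Q? (P⇒Q p)))

sum-point : ∀ {n} (v : Fin n) → sum (λ u → ⟦ u ≟ v ⟧) ≡ 1
sum-point {suc n} zero    = cong suc (trans (sum-const n 0) (*-zeroʳ n))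
sum-point {suc n} (suc v) = trans (sum-cong-≗ shift) (sum-point v)
  where
  shift : ∀ u → ⟦ suc u ≟ suc v ⟧ ≡ ⟦ u ≟ v ⟧
  shift u with u ≟ v
  ... | yes _ = refl
  ... | no  _ = refl

-- Decidable subsets of a finite set and their cardinalities

Subset : ℕ → Set
Subset n = Fin n → Bool

infix 4 _∈_ _∉_ _⊆_ _∈?_
_∈_ _∉_ : ∀ {n} → Fin n → Subset n → Set
v ∈ X = X v ≡ true
v ∉ X = ¬ v ∈ X

_⊆_ : ∀ {n} → Subset n → Subset n → Set
X ⊆ Y = ∀ {v} → v ∈ X → v ∈ Y

_∈?_ : ∀ {n} (v : Fin n) (X : Subset n) → Dec (v ∈ X)
v ∈? X with X v
... | true  = yes refl
... | false = no λ ()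

χ-yes : ∀ {n} {v : Fin n} (X : Subset n) → v ∈ X → χ (X v) ≡ 1
χ-yes X v∈X rewrite v∈X = refl

χ-no : ∀ {n} {v : Fin n} (X : Subset n) → v ∉ X → χ (X v) ≡ 0
χ-no {v = v} X v∉X with X v
... | true  = ⊥-elim (v∉X refl)
... | false = refl

χ-mono : ∀ {n} (X Y : Subset n) {u v} → (u ∈ X → v ∈ Y) → χ (X u) ≤ χ (Y v)
χ-mono X Y {u} {v} X⇒Y with X u
... | false = z≤n
... | true  = ≤-reflexive (sym (χ-yes Y (X⇒Y refl)))

full : ∀ {n} → Subset n
full _ = true

comprehension : ∀ {n p} {P : Fin n → Set p} → (∀ v → Dec (P v)) → Subset n
comprehension P? v = does (P? v)

∈-comp⁺ : ∀ {n p} {P : Fin n → Set p} (P? : ∀ v → Dec (P v)) {v} → P v → v ∈ comprehension P?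
∈-comp⁺ P? {v} p = dec-true (P? v) p

∈-comp⁻ : ∀ {n p} {P : Fin n → Set p} (P? : ∀ v → Dec (P v)) {v} → v ∈ comprehension P? → P v
∈-comp⁻ P? {v} v∈ = does⇒ (P? v) v∈

infixl 6 _-_ _∪_ _∩_ _∖_
_-_ : ∀ {n} → Subset n → Fin n → Subset n
(X - v) u = X u ∧ not (does (u ≟ v))

_∪_ _∩_ _∖_ : ∀ {n} → Subset n → Subset n → Subset n
(X ∪ Y) v = X v ∨ Y v
(X ∩ Y) v = X v ∧ Y v
(X ∖ Y) v = X v ∧ not (Y v)

∈-remove⁺ : ∀ {n} (X : Subset n) {u v} → u ∈ X → u ≢ v → u ∈ X - v
∈-remove⁺ X {u} {v} u∈X u≢v rewrite u∈X | dec-false (u ≟ v) u≢v = refl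

∈-remove⁻ : ∀ {n} (X : Subset n) {u v} → u ∈ X - v → u ∈ X × u ≢ v
∈-remove⁻ X {u} {v} u∈ with X u | u ≟ v
... | true | no u≢v = refl , u≢v

∈-∪⁺ˡ : ∀ {n} (X Y : Subset n) {v} → v ∈ X → v ∈ X ∪ Y
∈-∪⁺ˡ X Y v∈X rewrite v∈X = refl

∈-∪⁺ʳ : ∀ {n} (X Y : Subset n) {v} → v ∈ Y → v ∈ X ∪ Y
∈-∪⁺ʳ X Y {v} v∈Y with X v
... | true  = refl
... | false = v∈Y

∈-∪⁻ : ∀ {n} (X Y : Subset n) {v} → v ∈ X ∪ Y → v ∈ X ⊎ v ∈ Y
∈-∪⁻ X Y {v} v∈ with X v
... | true  = inj₁ refl
... | false = inj₂ v∈

∈-∩⁺ : ∀ {n} (X Y : Subset n) {v} → v ∈ X → v ∈ Y → v ∈ X ∩ Y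
∈-∩⁺ X Y v∈X v∈Y rewrite v∈X = v∈Y

∈-∩⁻ : ∀ {n} (X Y : Subset n) {v} → v ∈ X ∩ Y → v ∈ X × v ∈ Y
∈-∩⁻ X Y {v} v∈ with X v
... | true = refl , v∈

∈-∖⁺ : ∀ {n} (X Y : Subset n) {v} → v ∈ X → v ∉ Y → v ∈ X ∖ Y
∈-∖⁺ X Y {v} v∈X v∉Y rewrite v∈X with Y v
... | true  = ⊥-elim (v∉Y refl)
... | false = refl

∈-∖⁻ : ∀ {n} (X Y : Subset n) {v} → v ∈ X ∖ Y → v ∈ X × v ∉ Y
∈-∖⁻ X Y {v} v∈ with X v | Y v
... | true | false = refl , λ ()

card : ∀ {n} → Subset n → ℕ
card X = sum (χ ∘ X)

card-mono : ∀ {n} (X Y : Subset n) → X ⊆ Y → card X ≤ card Y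
card-mono X Y X⊆Y = sum-mono (λ v → χ-mono X Y {v} X⊆Y)

card-full : ∀ n → card (full {n}) ≡ n
card-full n = trans (sum-const n 1) (*-identityʳ n)

card≤n : ∀ {n} (X : Subset n) → card X ≤ n
card≤n {n} X = ≤-trans (card-mono X full (λ _ → refl)) (≤-reflexive (card-full n))

card-split : ∀ {n} (X Y : Subset n) → card X ≡ card (X ∩ Y) + card (X ∖ Y)
card-split X Y = trans (sum-cong-≗ pointwise) (∑-distrib-+ (χ ∘ (X ∩ Y)) (χ ∘ (X ∖ Y)))
  where
  pointwise : ∀ v → χ (X v) ≡ χ (X v ∧ Y v) + χ (X v ∧ not (Y v))
  pointwise v with X v | Y v
  ... | true  | true  = refl
  ... | true  | false = refl
  ... | false | _     = refl

card-∪ : ∀ {n} (X Y : Subset n) → card (X ∪ Y) ≤ card X + card Y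
card-∪ X Y = sum-+-mono pointwise
  where
  pointwise : ∀ v → χ (X v ∨ Y v) ≤ χ (X v) + χ (Y v)
  pointwise v with X v
  ... | true  = s≤s z≤n
  ... | false = ≤-refl

card-remove : ∀ {n} (X : Subset n) {v} → v ∈ X → card X ≡ suc (card (X - v))
card-remove X {v} v∈X = begin
  card X                                      ≡⟨ sum-cong-≗ pointwise ⟩
  sum (λ u → ⟦ u ≟ v ⟧ + χ ((X - v) u))       ≡⟨ ∑-distrib-+ (λ u → ⟦ u ≟ v ⟧) (χ ∘ (X - v)) ⟩
  sum (λ u → ⟦ u ≟ v ⟧) + card (X - v)        ≡⟨ cong (_+ card (X - v)) (sum-point v) ⟩
  suc (card (X - v))                          ∎
  where
  open ≡-Reasoning
  pointwise : ∀ u → χ (X u) ≡ ⟦ u ≟ v ⟧ + χ ((X - v) u)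
  pointwise u with u ≟ v
  pointwise u | yes refl rewrite v∈X = refl
  pointwise u | no  _ with X u
  ... | true  = refl
  ... | false = refl

card-disjoint : ∀ {n} (X Y : Subset n) → (∀ {v} → v ∈ X → v ∉ Y) → card X + card Y ≤ n
card-disjoint {n} X Y disjoint = ≤-trans (≤-reflexive (sym (∑-distrib-+ (χ ∘ X) (χ ∘ Y))))
  (≤-trans (sum-mono pointwise) (≤-reflexive (card-full n)))
  where
  pointwise : ∀ v → χ (X v) + χ (Y v) ≤ 1
  pointwise v with v ∈? X
  ... | yes v∈X rewrite χ-yes X v∈X | χ-no Y (disjoint v∈X) = ≤-refl
  ... | no  v∉X rewrite χ-no X v∉X = χ≤1 (Y v)

card-witness : ∀ {n} (X : Subset n) {v} → v ∈ X → 1 ≤ card X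
card-witness X {v} v∈X = ≤-trans (≤-reflexive (sym (χ-yes X v∈X))) (term≤sum (χ ∘ X) v)

card-pair : ∀ {n} (X : Subset n) {u v} → u ∈ X → v ∈ X → u ≢ v → 2 ≤ card X
card-pair X {u} {v} u∈X v∈X u≢v rewrite card-remove X v∈X = s≤s (card-witness (X - v) (∈-remove⁺ X u∈X u≢v))

card-triple : ∀ {n} (X : Subset n) {u v w} → u ∈ X → v ∈ X → w ∈ X → u ≢ v → u ≢ w → v ≢ w → 3 ≤ card X
card-triple X {w = w} u∈X v∈X w∈X u≢v u≢w v≢w rewrite card-remove X w∈X =
  s≤s (card-pair (X - w) (∈-remove⁺ X u∈X u≢w) (∈-remove⁺ X v∈X v≢w) u≢v)

singleton : ∀ {n} → Fin n → Subset n
singleton v = comprehension (_≟ v)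

∈-singleton⁺ : ∀ {n} (v : Fin n) → v ∈ singleton v
∈-singleton⁺ v = ∈-comp⁺ (_≟ v) {v} refl

∈-singleton⁻ : ∀ {n} (u v : Fin n) → u ∈ singleton v → u ≡ v
∈-singleton⁻ u v u∈ = ∈-comp⁻ (_≟ v) {u} u∈

card-singleton : ∀ {n} (v : Fin n) → card (singleton v) ≡ 1
card-singleton = sum-point

inhabited? : ∀ {n} (X : Subset n) → (∃ λ v → v ∈ X) ⊎ (card X ≡ 0)
inhabited? {n} X with Fin.any? (_∈? X)
... | yes v∈X = inj₁ v∈X
... | no  ∄v  = inj₂ (trans (sum-cong-≗ (λ v → χ-no X (λ v∈X → ∄v (v , v∈X)))) (trans (sum-const n 0) (*-zeroʳ n)))

-- Strong induction on cardinality. The refuting form provides a smallest witness of an arbitrary P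
-- without a decision procedure, which suffices because every use aims at a contradiction.
minimal : ∀ {n p} (P : Subset n → Set p) →
  (∀ W → P W → (∀ W′ → card W′ < card W → ¬ P W′) → ⊥) → ∀ W → ¬ P W
minimal P refute W PW = go (suc (card W)) W ≤-refl PW
  where
  go : ∀ k W → card W < k → ¬ P W
  go (suc k) W (s≤s |W|≤k) PW = refute W PW (λ W′ |W′|<|W| → go k W′ (<-≤-trans |W′|<|W| |W|≤k))

-- Rainbow trails and rainbow cycles

module Trails {n : ℕ} (G : ColouredGraph n) where

  Edge : Set
  Edge = Fin (m G)

  col : Edge → Fin n
  col = colour G

  joins-sym : ∀ {e u v} → Joins G e u v → Joins G e v u
  joins-sym (inj₁ p) = inj₂ p
  joins-sym (inj₂ p) = inj₁ p

  joins-irrefl : ∀ {e u} → ¬ Joins G e u u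
  joins-irrefl {e} (inj₁ (p , q)) = noLoops G e (trans p (sym q))
  joins-irrefl {e} (inj₂ (p , q)) = noLoops G e (trans p (sym q))

  next-value : ∀ {k} (v : ℕ → Fin n) → v (suc (suc k)) ≡ v 0 → (i : Fin (suc (suc k))) →
    v (suc (toℕ i)) ≡ v (toℕ (next i))
  next-value {k} v closed i with m≤n⇒m<n∨m≡n (toℕ<n i)
  ... | inj₁ 1+i<  = cong v (sym (trans (toℕ-fromℕ< _) (m<n⇒m%n≡m 1+i<)))
  ... | inj₂ 1+i≡ = trans (trans (cong v 1+i≡) closed) (cong v (sym (trans (toℕ-fromℕ< (m%n<n (suc (toℕ i)) (suc (suc k))))
      (trans (cong (λ x → x % suc (suc k)) 1+i≡) (n%n≡0 (suc (suc k)))))))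

  -- Indexing by all natural numbers makes a subtrail a mere shift. Vertices may repeat; only the
  -- colours are distinct.
  record ClosedTrail (p : ℕ) : Set where
    field
      vertexAt : ℕ → Fin n
      edgeAt   : ℕ → Edge
      joined   : ∀ i → i < p → Joins G (edgeAt i) (vertexAt i) (vertexAt (suc i))
      closed   : vertexAt p ≡ vertexAt 0
      coloured : ∀ i j → i < j → j < p → col (edgeAt i) ≢ col (edgeAt j)
  open ClosedTrail

  subtrail : ∀ {p} (t : ClosedTrail p) i d → i + d < p → vertexAt t i ≡ vertexAt t (i + d) → ClosedTrail d
  subtrail t i d i+d<p eq = record
    { vertexAt = λ a → vertexAt t (i + a)
    ; edgeAt   = λ a → edgeAt t (i + a)
    ; joined   = λ a a<d → subst (λ x → Joins G (edgeAt t (i + a)) (vertexAt t (i + a)) (vertexAt t x))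
                   (sym (+-suc i a)) (joined t (i + a) (<-trans (+-monoʳ-< i a<d) i+d<p))
    ; closed   = trans (sym eq) (cong (vertexAt t) (sym (+-identityʳ i)))
    ; coloured = λ a b a<b b<d → coloured t (i + a) (i + b) (+-monoʳ-< i a<b) (<-trans (+-monoʳ-< i b<d) i+d<p)
    }

  Repetition : ∀ {p} → ClosedTrail p → Set
  Repetition {p} t = ∃ λ (i : Fin p) → ∃ λ (j : Fin p) → toℕ i < toℕ j × vertexAt t (toℕ i) ≡ vertexAt t (toℕ j)

  simple-cycle : ∀ {k} (t : ClosedTrail (suc (suc k))) → ¬ Repetition t → RainbowCycle G k
  simple-cycle {k} t ¬rep = record
    { vertex    = vertexAt t ∘ toℕ
    ; edge      = edgeAt t ∘ toℕ
    ; vertexInj = λ {i} {j} → vertexInj′ i j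
    ; joins     = λ i → subst (Joins G (edgeAt t (toℕ i)) (vertexAt t (toℕ i)))
                    (next-value (vertexAt t) (closed t) i) (joined t (toℕ i) (toℕ<n i))
    ; rainbow   = λ {i} {j} → rainbow′ i j
    }
    where
    vertexInj′ : ∀ i j → vertexAt t (toℕ i) ≡ vertexAt t (toℕ j) → i ≡ j
    vertexInj′ i j eq with <-cmp (toℕ i) (toℕ j)
    ... | tri< i<j _ _ = ⊥-elim (¬rep (i , j , i<j , eq))
    ... | tri≈ _ i≡j _ = toℕ-injective i≡j
    ... | tri> _ _ j<i = ⊥-elim (¬rep (j , i , j<i , sym eq))
    rainbow′ : ∀ i j → col (edgeAt t (toℕ i)) ≡ col (edgeAt t (toℕ j)) → i ≡ j
    rainbow′ i j eq with <-cmp (toℕ i) (toℕ j)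
    ... | tri< i<j _ _ = ⊥-elim (coloured t _ _ i<j (toℕ<n j) eq)
    ... | tri≈ _ i≡j _ = toℕ-injective i≡j
    ... | tri> _ _ j<i = ⊥-elim (coloured t _ _ j<i (toℕ<n i) (sym eq))

  -- If positions i < j carry the same vertex, the stretch between them is a shorter closed trail,
  -- still rainbow. The descent cannot reach length one, as there are no loops; `b` is its fuel.
  closed-trail⇒cycle : ∀ p → 1 ≤ p → ClosedTrail p → ∃ λ k → RainbowCycle G k × cycleLength k ≤ p
  closed-trail⇒cycle p 1≤p t = go p p ≤-refl 1≤p t
    where
    go : ∀ b p → p ≤ b → 1 ≤ p → ClosedTrail p → ∃ λ k → RainbowCycle G k × cycleLength k ≤ p
    go (suc b) (suc zero) p≤b 1≤p t =
      ⊥-elim (joins-irrefl (subst (Joins G (edgeAt t 0) (vertexAt t 0)) (closed t) (joined t 0 (s≤s z≤n))))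
    go (suc b) (suc (suc k)) (s≤s p≤b) 1≤p t
      with Fin.any? (λ i → Fin.any? (λ j → (suc (toℕ i) ≤? toℕ j) ×-dec (vertexAt t (toℕ i) Fin.≟ vertexAt t (toℕ j))))
    ... | no ¬rep = k , simple-cycle t ¬rep , ≤-refl
    ... | yes (i , j , i<j , eq) with go b d (≤-trans d≤ p≤b) (m<n⇒0<n∸m i<j) (subtrail t (toℕ i) d i+d< (trans eq (cong (vertexAt t) (sym i+d≡j))))
      where
      d = toℕ j ∸ toℕ i
      i+d≡j : toℕ i + d ≡ toℕ j
      i+d≡j = m+[n∸m]≡n (<⇒≤ i<j)
      d≤ : d ≤ suc k
      d≤ = ≤-trans (m∸n≤m (toℕ j) (toℕ i)) (s≤s⁻¹ (toℕ<n j))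
      i+d< : toℕ i + d < suc (suc k)
      i+d< = subst (_< suc (suc k)) (sym i+d≡j) (toℕ<n j)
    ... | k′ , C , len≤ = k′ , C , ≤-trans len≤ (≤-trans (m∸n≤m (toℕ j) (toℕ i)) (<⇒≤ (toℕ<n j)))

  infixr 5 _∷_
  data Trail : Fin n → Fin n → List Edge → Set where
    []  : ∀ {x} → Trail x x []
    _∷_ : ∀ {x y z e es} → Joins G e x y → Trail y z es → Trail x z (e ∷ es)

  -- Counting turns rainbowness into `occ c es ≤ 1` for every c. The count is additive under
  -- concatenation and blind to direction, so merging and reversing paths needs no argument about
  -- distinctness.
  occ : Fin n → List Edge → ℕ
  occ c []       = 0
  occ c (e ∷ es) = ⟦ col e ≟ c ⟧ + occ c es

  occ-++ : ∀ c es fs → occ c (es ++ fs) ≡ occ c es + occ c fs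
  occ-++ c []       fs = refl
  occ-++ c (e ∷ es) fs = trans (cong (⟦ col e ≟ c ⟧ +_) (occ-++ c es fs)) (sym (+-assoc ⟦ col e ≟ c ⟧ (occ c es) (occ c fs)))

  _++ᵗ_ : ∀ {x y z es fs} → Trail x y es → Trail y z fs → Trail x z (es ++ fs)
  []      ++ᵗ t = t
  (j ∷ s) ++ᵗ t = j ∷ (s ++ᵗ t)

  reverse-trail : ∀ {x y es} → Trail x y es →
    ∃ λ fs → Trail y x fs × length fs ≡ length es × (∀ c → occ c fs ≡ occ c es)
  reverse-trail [] = [] , [] , refl , λ c → refl
  reverse-trail {es = e ∷ es} (j ∷ t) with reverse-trail t
  ... | fs , t′ , len , same = fs ++ [ e ] , (t′ ++ᵗ (joins-sym j ∷ [])) ,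
        trans (length-++ fs) (trans (+-comm (length fs) 1) (cong suc len)) ,
        λ c → trans (occ-++ c fs [ e ]) (trans (cong₂ _+_ (same c) (+-identityʳ ⟦ col e ≟ c ⟧)) (+-comm (occ c es) ⟦ col e ≟ c ⟧))

  trail-vertex : ∀ {x y es} → Trail x y es → ℕ → Fin n
  trail-vertex {x} _       zero    = x
  trail-vertex {x} []      (suc i) = x
  trail-vertex     (j ∷ t) (suc i) = trail-vertex t i

  trail-edge : Edge → List Edge → ℕ → Edge
  trail-edge d []       _       = d
  trail-edge d (e ∷ es) zero    = e
  trail-edge d (e ∷ es) (suc i) = trail-edge d es i

  trail-end : ∀ {x y es} (t : Trail x y es) → trail-vertex t (length es) ≡ y
  trail-end []      = refl
  trail-end (j ∷ t) = trail-end t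

  trail-joined : ∀ {x y es} d (t : Trail x y es) i → i < length es →
    Joins G (trail-edge d es i) (trail-vertex t i) (trail-vertex t (suc i))
  trail-joined d (j ∷ [])       zero    _         = j
  trail-joined d (j ∷ (j′ ∷ t)) zero    _         = j
  trail-joined d (j ∷ t)        (suc i) (s≤s i<l) = trail-joined d t i i<l

  occ-edge : ∀ d es i c → i < length es → col (trail-edge d es i) ≡ c → 1 ≤ occ c es
  occ-edge d (e ∷ es) zero    c _         refl = ≤-trans (≤-reflexive (sym (⟦⟧-yes (col e ≟ c) refl))) (m≤m+n _ _)
  occ-edge d (e ∷ es) (suc i) c (s≤s i<l) eq   = ≤-trans (occ-edge d es i c i<l eq) (m≤n+m _ ⟦ col e ≟ c ⟧)

  occ-edges : ∀ d es i j c → i < j → j < length es → col (trail-edge d es i) ≡ c → col (trail-edge d es j) ≡ c → 2 ≤ occ c es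
  occ-edges d (e ∷ es) zero    (suc j) c _         (s≤s j<l) refl eq₂ =
    ≤-reflexive (sym (⟦⟧-yes (col e ≟ c) refl)) ⊕ occ-edge d es j c j<l eq₂
  occ-edges d (e ∷ es) (suc i) (suc j) c (s≤s i<j) (s≤s j<l) eq₁ eq₂ =
    ≤-trans (occ-edges d es i j c i<j j<l eq₁ eq₂) (m≤n+m _ ⟦ col e ≟ c ⟧)

  rainbow-closed-trail : ∀ {x es} → Trail x x es → 1 ≤ length es → (∀ c → occ c es ≤ 1) →
    ∃ λ k → RainbowCycle G k × cycleLength k ≤ length es
  rainbow-closed-trail {es = e ∷ es} t 1≤ occ≤1 = closed-trail⇒cycle _ 1≤ (record
    { vertexAt = trail-vertex t
    ; edgeAt   = trail-edge e (e ∷ es)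
    ; joined   = trail-joined e t
    ; closed   = trail-end t
    ; coloured = λ i j i<j j<p eq → <⇒≱ (occ-edges e (e ∷ es) i j _ i<j j<p eq refl) (occ≤1 _)
    })

-- Multigraphs whose edges are paths of the original graph

module WeightedGraphs {n : ℕ} (G : ColouredGraph n) (g : ℕ)
  (girth : ∀ k → RainbowCycle G k → g ≤ cycleLength k) where

  open Trails G
  open ListAll using ([]; _∷_)

  -- An edge of the multigraph that remains after vertices have been suppressed. It may be a loop; a
  -- rainbow loop contains a rainbow cycle, whence `loop-weight`.
  record Link : Set where
    constructor link
    field
      {src tgt} : Fin n
      {path}    : List Edge
      trail     : Trail src tgt path
      nonempty  : 1 ≤ length path
  open Link public

  weight : Link → ℕ
  weight e = length (path e)

  uses : Fin n → Link → ℕ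
  uses c e = occ c (path e)

  record SameContent (e f : Link) : Set where
    field
      same-weight : weight e ≡ weight f
      same-uses   : ∀ c → uses c e ≡ uses c f
  open SameContent

  flip : ∀ e → ∃ λ f → src f ≡ tgt e × tgt f ≡ src e × SameContent f e
  flip (link t 1≤) with reverse-trail t
  ... | fs , t′ , len , same = link t′ (subst (1 ≤_) (sym len) 1≤) , refl , refl ,
        record { same-weight = len ; same-uses = same }

  join : ∀ e f → tgt e ≡ src f → ∃ λ h → src h ≡ src e × tgt h ≡ tgt f ×
    weight h ≡ weight e + weight f × (∀ c → uses c h ≡ uses c e + uses c f)
  join (link {path = es} s 1≤) (link {path = fs} t _) refl =
    link (s ++ᵗ t) (subst (1 ≤_) (sym (length-++ es)) (≤-trans 1≤ (m≤m+n _ _))) ,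
    refl , refl , length-++ es , λ c → occ-++ c es fs

  loop-weight : ∀ e → src e ≡ tgt e → (∀ c → uses c e ≤ 1) → g ≤ weight e
  loop-weight (link t 1≤) refl once with rainbow-closed-trail t 1≤ once
  ... | k , C , len≤ = ≤-trans (girth k C) len≤

  sumBy : (Link → ℕ) → List Link → ℕ
  sumBy μ []       = 0
  sumBy μ (e ∷ es) = μ e + sumBy μ es

  total : List Link → ℕ
  total = sumBy weight

  sumBy-1 : ∀ es → sumBy (λ _ → 1) es ≡ length es
  sumBy-1 []       = refl
  sumBy-1 (_ ∷ es) = cong suc (sumBy-1 es)

  sumBy-↭ : ∀ μ {es fs} → es ↭ fs → sumBy μ es ≡ sumBy μ fs
  sumBy-↭ μ Perm.refl = refl
  sumBy-↭ μ (Perm.prep e p) = cong (μ e +_) (sumBy-↭ μ p)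
  sumBy-↭ μ (Perm.swap {xs = es} e f p) = trans (exchange (μ e) (μ f) (sumBy μ es)) (cong (λ s → μ f + (μ e + s)) (sumBy-↭ μ p))
    where
    exchange : ∀ a b c → a + (b + c) ≡ b + (a + c)
    exchange = solve-∀
  sumBy-↭ μ (Perm.trans p q) = trans (sumBy-↭ μ p) (sumBy-↭ μ q)

  sumBy-++ : ∀ μ es fs → sumBy μ (es ++ fs) ≡ sumBy μ es + sumBy μ fs
  sumBy-++ μ []       fs = refl
  sumBy-++ μ (e ∷ es) fs = trans (cong (μ e +_) (sumBy-++ μ es fs)) (sym (+-assoc (μ e) (sumBy μ es) (sumBy μ fs)))

  sumBy-zero : ∀ μ es → All (λ e → μ e ≡ 0) es → sumBy μ es ≡ 0
  sumBy-zero μ []       []       = refl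
  sumBy-zero μ (e ∷ es) (p ∷ ps) = cong₂ _+_ p (sumBy-zero μ es ps)

  Loopless : Link → Set
  Loopless e = src e ≢ tgt e

  Touches : Fin n → Link → Set
  Touches v e = (v ≡ src e) ⊎ (v ≡ tgt e)

  touches? : ∀ v e → Dec (Touches v e)
  touches? v e = (v ≟ src e) ⊎-dec (v ≟ tgt e)

  Within : Subset n → Link → Set
  Within W e = src e ∈ W × tgt e ∈ W

  -- Here k is the excess of links over vertices. Rainbowness is required of all paths jointly, so
  -- that any closed trail made of distinct links is rainbow.
  record System (W : Subset n) (es : List Link) (k : ℕ) : Set where
    constructor system
    field
      within  : All (Within W) es
      size    : length es ≡ card W + k
      rainbow : ∀ c → sumBy (uses c) es ≤ 1
  open System

  system-↭ : ∀ {W es fs k} → es ↭ fs → System W es k → System W fs k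
  system-↭ p (system w s r) = system (All-resp-↭ p w) (trans (sym (↭-length p)) s)
    (λ c → subst (_≤ 1) (sumBy-↭ (uses c) p) (r c))

  system-tail : ∀ {W e es k} → System W (e ∷ es) (suc k) → System W es k
  system-tail {W} {k = k} (system (_ ∷ w) s r) =
    system w (suc-injective (trans s (+-suc (card W) k))) (λ c → ≤-trans (m≤n+m _ _) (r c))

  head-loop-weight : ∀ {W e es k} → System W (e ∷ es) k → src e ≡ tgt e → g ≤ weight e
  head-loop-weight {e = e} S loop = loop-weight e loop (λ c → ≤-trans (m≤m+n _ _) (rainbow S c))

  find : ∀ {P : Link → Set} → (∀ e → Dec (P e)) → ∀ es →
    (∃ λ e → ∃ λ fs → P e × es ↭ e ∷ fs) ⊎ All (¬_ ∘ P) es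
  find P? [] = inj₂ []
  find P? (e ∷ es) with P? e
  ... | yes p = inj₁ (e , es , p , ↭-refl)
  ... | no ¬p with find P? es
  ...   | inj₁ (f , fs , p , π) = inj₁ (f , e ∷ fs , p , ↭-trans (↭-prep e π) (↭-swap e f ↭-refl))
  ...   | inj₂ ¬ps = inj₂ (¬p ∷ ¬ps)

  star : ∀ v es → ∃ λ ts → ∃ λ rs → es ↭ ts ++ rs × All (Touches v) ts × All (¬_ ∘ Touches v) rs
  star v [] = [] , [] , ↭-refl , [] , []
  star v (e ∷ es) with star v es | touches? v e
  ... | ts , rs , π , t , r | yes p = e ∷ ts , rs , ↭-prep e π , p ∷ t , r
  ... | ts , rs , π , t , r | no ¬p = ts , e ∷ rs , ↭-trans (↭-prep e π) (↭-sym (↭-shift e ts rs)) , t , ¬p ∷ r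

  -- A loop at v counts twice, as the handshake identity demands.
  incidence : Fin n → Link → ℕ
  incidence v e = ⟦ v ≟ src e ⟧ + ⟦ v ≟ tgt e ⟧

  degree : (Link → ℕ) → Fin n → List Link → ℕ
  degree μ v = sumBy (λ e → incidence v e * μ e)

  deg : Fin n → List Link → ℕ
  deg = degree (λ _ → 1)

  handshake : ∀ μ es → sum (λ v → degree μ v es) ≡ 2 * sumBy μ es
  handshake μ []       = trans (sum-const n 0) (*-zeroʳ n)
  handshake μ (e ∷ es) = begin
    sum (λ v → incidence v e * μ e + degree μ v es)           ≡⟨ ∑-distrib-+ (λ v → incidence v e * μ e) (λ v → degree μ v es) ⟩
    sum (λ v → incidence v e * μ e) + sum (λ v → degree μ v es) ≡⟨ cong₂ _+_ ends (handshake μ es) ⟩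
    2 * μ e + 2 * sumBy μ es                                  ≡⟨ sym (*-distribˡ-+ 2 (μ e) (sumBy μ es)) ⟩
    2 * (μ e + sumBy μ es)                                    ∎
    where
    open ≡-Reasoning
    ends : sum (λ v → incidence v e * μ e) ≡ 2 * μ e
    ends = trans (sym (*-distribʳ-sum (μ e) (λ v → incidence v e)))
      (cong (_* μ e) (trans (∑-distrib-+ (λ v → ⟦ v ≟ src e ⟧) (λ v → ⟦ v ≟ tgt e ⟧))
                            (cong₂ _+_ (sum-point (src e)) (sum-point (tgt e)))))

  incidence-yes : ∀ v e → Touches v e → 1 ≤ incidence v e
  incidence-yes v e (inj₁ p) = ≤-trans (≤-reflexive (sym (⟦⟧-yes (v ≟ src e) p))) (m≤m+n _ _)
  incidence-yes v e (inj₂ p) = ≤-trans (≤-reflexive (sym (⟦⟧-yes (v ≟ tgt e) p))) (m≤n+m _ ⟦ v ≟ src e ⟧)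

  incidence-loopless : ∀ v e → Loopless e → incidence v e ≤ 1
  incidence-loopless v e s≢t with v ≟ src e | v ≟ tgt e
  ... | yes p | yes q = ⊥-elim (s≢t (trans (sym p) q))
  ... | yes _ | no _  = ≤-refl
  ... | no _  | yes _ = ≤-refl
  ... | no _  | no _  = z≤n

  incidence-no : ∀ v e → ¬ Touches v e → incidence v e ≡ 0
  incidence-no v e ¬t = cong₂ _+_ (⟦⟧-no (v ≟ src e) (¬t ∘ inj₁)) (⟦⟧-no (v ≟ tgt e) (¬t ∘ inj₂))

  degree-no : ∀ μ v es → All (¬_ ∘ Touches v) es → degree μ v es ≡ 0
  degree-no μ v es ¬ts = sumBy-zero _ es (ListAll.map (λ {e} ¬t → cong (_* μ e) (incidence-no v e ¬t)) ¬ts)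

  degree-outside : ∀ {W} μ v es → v ∉ W → All (Within W) es → degree μ v es ≡ 0
  degree-outside {W} μ v es v∉W w = degree-no μ v es (ListAll.map
    (λ { (s , _) (inj₁ refl) → v∉W s ; (_ , t) (inj₂ refl) → v∉W t }) w)

  length≤deg : ∀ v es → All (Touches v) es → length es ≤ deg v es
  length≤deg v []       []       = z≤n
  length≤deg v (e ∷ es) (t ∷ ts) = ≤-trans (incidence-yes v e t) (m≤m*n (incidence v e) 1) ⊕ length≤deg v es ts

  degree≤sumBy : ∀ μ v es → All Loopless es → degree μ v es ≤ sumBy μ es
  degree≤sumBy μ v []       []       = z≤n
  degree≤sumBy μ v (e ∷ es) (l ∷ ls) =
    ≤-trans (*-monoˡ-≤ (μ e) (incidence-loopless v e l)) (≤-reflexive (+-identityʳ (μ e))) ⊕ degree≤sumBy μ v es ls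

  min-degree-count : ∀ {W} es → (∀ v → v ∈ W → 3 ≤ deg v es) → 3 * card W ≤ 2 * length es
  min-degree-count {W} es 3≤deg = begin
    3 * card W                ≡⟨ *-distribˡ-sum 3 (χ ∘ W) ⟩
    sum (λ v → 3 * χ (W v))   ≤⟨ sum-mono pointwise ⟩
    sum (λ v → deg v es)      ≡⟨ handshake (λ _ → 1) es ⟩
    2 * sumBy (λ _ → 1) es    ≡⟨ cong (2 *_) (sumBy-1 es) ⟩
    2 * length es             ∎
    where
    open ≤-Reasoning
    pointwise : ∀ v → 3 * χ (W v) ≤ deg v es
    pointwise v with v ∈? W
    ... | yes v∈W rewrite v∈W = 3≤deg v v∈W
    ... | no  v∉W rewrite χ-no W v∉W = z≤n

  orient-into : ∀ {W v} e → Touches v e → Loopless e → Within W e →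
    ∃ λ f → tgt f ≡ v × src f ∈ W × src f ≢ v × SameContent f e
  orient-into {W} e (inj₂ v≡tgt) s≢t (s∈W , _) = e , sym v≡tgt , s∈W , (λ s≡v → s≢t (trans s≡v v≡tgt)) ,
    record { same-weight = refl ; same-uses = λ c → refl }
  orient-into {W} e (inj₁ v≡src) s≢t (_ , t∈W) with flip e
  ... | f , sf , tf , same = f , trans tf (sym v≡src) , subst (_∈ W) (sym sf) t∈W ,
        (λ sf≡v → s≢t (trans (sym v≡src) (trans (sym sf≡v) sf))) , same

  orient-out : ∀ {W v} e → Touches v e → Loopless e → Within W e →
    ∃ λ f → src f ≡ v × tgt f ∈ W × tgt f ≢ v × SameContent f e
  orient-out {W} e t l w with orient-into e t l w
  ... | f , tf , sf∈ , sf≢ , same with flip f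
  ...   | h , sh , th , same′ = h , trans sh tf , subst (_∈ W) (sym th) sf∈ , (λ th≡v → sf≢ (trans (sym th) th≡v)) ,
          record { same-weight = trans (same-weight same′) (same-weight same)
                 ; same-uses   = λ c → trans (same-uses same′ c) (same-uses same c) }

  -- Two links meeting at v are replaced by the single link through v.
  bypass : ∀ {W v} e f → Touches v e → Touches v f → Loopless e → Loopless f → Within W e → Within W f →
    ∃ λ h → Within (W - v) h × weight h ≡ weight e + weight f × (∀ c → uses c h ≡ uses c e + uses c f)
  bypass {W} e f te tf le lf we wf with orient-into e te le we | orient-out f tf lf wf
  ... | e′ , te′ , se∈ , se≢ , same | f′ , sf′ , tf∈ , tf≢ , same′ with join e′ f′ (trans te′ (sym sf′))
  ...   | h , sh , th , wh , uh = h ,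
          (subst (_∈ (W - _)) (sym sh) (∈-remove⁺ W se∈ se≢) , subst (_∈ (W - _)) (sym th) (∈-remove⁺ W tf∈ tf≢)) ,
          trans wh (cong₂ _+_ (same-weight same) (same-weight same′)) ,
          λ c → trans (uh c) (cong₂ _+_ (same-uses same c) (same-uses same′ c))

  within-remove : ∀ {W v es} → All (Within W) es → All (¬_ ∘ Touches v) es → All (Within (W - v)) es
  within-remove {W} w ¬t = ListAll.zipWith (λ { ((s , t) , ¬t) → ∈-remove⁺ W s (¬t ∘ inj₁ ∘ sym) , ∈-remove⁺ W t (¬t ∘ inj₂ ∘ sym) }) (w , ¬t)

  -- Removing vertices of degree at most two preserves the excess |es| − |W|; loops and the case of
  -- minimum degree three are left to the caller.
  module Reduction (k : ℕ) (Q : ℕ → Set) (Q-mono : ∀ {a b} → a ≤ b → Q a → Q b)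
    (loop-case : ∀ {W e es} → System W (e ∷ es) k → 1 ≤ card W → src e ≡ tgt e → Q (total (e ∷ es)))
    (cubic-case : ∀ {W es} → System W es k → 1 ≤ card W → All Loopless es →
      (∀ v → v ∈ W → 3 ≤ deg v es) → Q (total es)) where

    reduce : ∀ N W es → card W ≤ N → 1 ≤ card W → System W es k → Q (total es)
    reduce zero    W es |W|≤0 1≤|W| S = ⊥-elim (<⇒≱ 1≤|W| |W|≤0)
    reduce (suc N) W es |W|≤N 1≤|W| S with find (λ e → src e ≟ tgt e) es
    ... | inj₁ (e , fs , loop , π) = subst Q (sym (sumBy-↭ weight π)) (loop-case (system-↭ π S) 1≤|W| loop)
    ... | inj₂ loopless with Fin.any? (λ v → (v ∈? W) ×-dec (deg v es <? 3))
    ...   | no ¬low = cubic-case S 1≤|W| loopless (λ v v∈W → ≮⇒≥ (λ d<3 → ¬low (v , v∈W , d<3)))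
    ...   | yes (v , v∈W , d<3) with star v es
    ...     | ts , rs , π , t , ¬t = subst Q (sym (sumBy-↭ weight π))
                (remove-vertex ts t (system-↭ π S) (All-resp-↭ π loopless) (subst (_< 3) (sumBy-↭ _ π) d<3))
      where
      |W|≡ : card W ≡ suc (card (W - v))
      |W|≡ = card-remove W v∈W
      |W-v|≤N : card (W - v) ≤ N
      |W-v|≤N = s≤s⁻¹ (subst (_≤ suc N) |W|≡ |W|≤N)
      recurse : ∀ es′ → 2 ≤ card W → System (W - v) es′ k → Q (total es′)
      recurse es′ 2≤ = reduce N (W - v) es′ |W-v|≤N (s≤s⁻¹ (subst (2 ≤_) |W|≡ 2≤))
      size≡ : ∀ {l} → suc l ≡ card W + k → l ≡ card (W - v) + k
      size≡ eq = suc-injective (trans eq (cong (_+ k) |W|≡))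
      -- A loopless link has two ends in W, which keeps `W - v` nonempty.
      two : ∀ e → Loopless e → Within W e → 2 ≤ card W
      two e l (s , t) = card-pair W s t l
      -- Deleting an isolated vertex alone would raise the excess, so an arbitrary link is given up
      -- with it.
      drop-head : ∀ rs → All (¬_ ∘ Touches v) rs → System W rs k → All Loopless rs → Q (total rs)
      drop-head [] _ (system _ size _) _ = ⊥-elim (<⇒≱ 1≤|W| (≤-trans (m≤m+n (card W) k) (≤-reflexive (sym size))))
      drop-head (e ∷ es′) (_ ∷ ¬t′) (system (we ∷ w) s r) (le ∷ _) = Q-mono (m≤n+m _ (weight e)) (recurse es′ (two e le we)
        (system (within-remove w ¬t′) (size≡ s) (λ c → ≤-trans (m≤n+m _ (uses c e)) (r c))))
      remove-vertex : ∀ ts → All (Touches v) ts → System W (ts ++ rs) k → All Loopless (ts ++ rs) →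
        deg v (ts ++ rs) < 3 → Q (total (ts ++ rs))
      remove-vertex [] [] S l d = drop-head rs ¬t S l
      remove-vertex (e ∷ []) t S l d with S | l
      ... | system (we ∷ w) s r | le ∷ _ = Q-mono (m≤n+m _ (weight e)) (recurse rs (two e le we)
              (system (within-remove w ¬t) (size≡ s) (λ c → ≤-trans (m≤n+m _ (uses c e)) (r c))))
      -- If both links lead to the same vertex, `h` is a loop, and the next round ends in
      -- `loop-case`.
      remove-vertex (e ∷ f ∷ []) (te ∷ tf ∷ []) S l d with S | l
      ... | system (we ∷ wf ∷ w) s r | le ∷ lf ∷ _ with bypass e f te tf le lf we wf
      ...   | h , wh , weight≡ , uses≡ = subst Q (trans (cong (_+ total rs) weight≡) (+-assoc (weight e) (weight f) (total rs)))
                (recurse (h ∷ rs) (two e le we) (system (wh ∷ within-remove w ¬t) (size≡ s)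
                  (λ c → subst (_≤ 1) (sym (trans (cong (_+ sumBy (uses c) rs) (uses≡ c)) (+-assoc (uses c e) (uses c f) _))) (r c))))
      remove-vertex (e ∷ f ∷ h ∷ ts) t S l d = ⊥-elim (<⇒≱ d (≤-trans
        (≤-trans (s≤s (s≤s (s≤s z≤n))) (length≤deg v (e ∷ f ∷ h ∷ ts) t))
        (≤-trans (m≤m+n _ _) (≤-reflexive (sym (sumBy-++ (λ e → incidence v e * 1) (e ∷ f ∷ h ∷ ts) rs))))))

-- Weight bounds for excess zero to three

cubic⇒few₀ : ∀ N → 1 ≤ N → 3 * N ≤ 2 * (N + 0) → ⊥
-- Numerical contradictions, here and below, derive the absurd 1 ≤ 0. The number handed to `linear`
-- is the surplus and shows how far a case is from being tight.
cubic⇒few₀ N h₁ h₂ = <⇒≱ (linear {1} {0} 0 (h₁ ⊕ h₂) (solve (N ∷ []))) ≤-refl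

cubic⇒few : ∀ N k → 3 * N ≤ 2 * (N + k) → N ≤ 2 * k
cubic⇒few N k h = linear 0 h (solve (N ∷ k ∷ []))

loop₁ : ∀ g w t → g ≤ w → g ≤ t → 3 * g ≤ 2 * (w + t)
loop₁ g w t g≤w g≤t = linear g (2 ⊛ g≤w ⊕ 2 ⊛ g≤t) (solve (g ∷ w ∷ t ∷ []))

loop₂ : ∀ g w t → g ≤ w → 3 * g ≤ 2 * t → 2 * g ≤ w + t
loop₂ g w t g≤w 3g≤2t = *-cancelˡ-≤ 2 (linear g (2 ⊛ g≤w ⊕ 3g≤2t) (solve (g ∷ w ∷ t ∷ [])))

loop₃ : ∀ g w t → g ≤ w → 2 * g ≤ t → 9 * g ≤ 4 * (w + t)
loop₃ g w t g≤w 2g≤t = linear (3 * g) (4 ⊛ g≤w ⊕ 4 ⊛ 2g≤t) (solve (g ∷ w ∷ t ∷ []))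

heavy₁ : ∀ g w t → w + t ≤ 3 * w → g ≤ t → 3 * g ≤ 2 * (w + t)
heavy₁ g w t heavy g≤t = linear 0 (3 ⊛ g≤t ⊕ heavy) (solve (g ∷ w ∷ t ∷ []))

heavy₃ : ∀ g w t → w + t ≤ 9 * w → 2 * g ≤ t → 9 * g ≤ 4 * (w + t)
heavy₃ g w t heavy 2g≤t = *-cancelˡ-≤ 2 (linear 0 (9 ⊛ 2g≤t ⊕ heavy) (solve (g ∷ w ∷ t ∷ [])))

module ExcessBounds {n : ℕ} (G : ColouredGraph n) (g : ℕ)
  (girth : ∀ k → RainbowCycle G k → g ≤ cycleLength k) where

  open Trails G
  open WeightedGraphs G g girth
  open System
  open SameContent
  open ListAll using ([]; _∷_)

  -- Minimum degree three would force 3|W| ≤ 2|W|, so the reduction must run into a loop, and that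
  -- loop weighs at least g.
  excess₀ : ∀ {W es} → 1 ≤ card W → System W es 0 → g ≤ total es
  excess₀ {W} {es} = Reduction.reduce 0 (g ≤_) (λ a≤b g≤a → ≤-trans g≤a a≤b)
    (λ S _ loop → ≤-trans (head-loop-weight S loop) (m≤m+n _ _))
    (λ {W} {es} S 1≤ _ cubic → ⊥-elim (cubic⇒few₀ (card W) 1≤
      (subst (λ l → 3 * card W ≤ 2 * l) (size S) (min-degree-count es cubic))))
    _ W es ≤-refl

  few-links : ∀ {W es} k → System W es k → (∀ v → v ∈ W → 3 ≤ deg v es) → card W ≤ 2 * k
  few-links {W} {es} k S cubic = cubic⇒few (card W) k
    (subst (λ l → 3 * card W ≤ 2 * l) (size S) (min-degree-count es cubic))

  heaviest : ∀ e es → ∃ λ f → ∃ λ fs → e ∷ es ↭ f ∷ fs × total (e ∷ es) ≤ length (e ∷ es) * weight f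
  heaviest e [] = e , [] , ↭-refl , ≤-refl
  heaviest e (e′ ∷ es) with heaviest e′ es
  ... | f , fs , π , heavy with ≤-total (weight e) (weight f)
  ...   | inj₁ e≤f = f , e ∷ fs , ↭-trans (↭-prep e π) (↭-swap e f ↭-refl) , (e≤f ⊕ heavy)
  ...   | inj₂ f≤e = e , e′ ∷ es , ↭-refl , +-monoʳ-≤ (weight e) (≤-trans heavy (*-monoʳ-≤ (length (e′ ∷ es)) f≤e))

  heaviest-link : ∀ {W es k} c → System W es (suc k) → card W + suc k ≤ c →
    ∃ λ f → ∃ λ fs → es ↭ f ∷ fs × weight f + total fs ≤ c * weight f
  heaviest-link {W} {[]} {k} c S _ = ⊥-elim (<⇒≱ (s≤s z≤n) (≤-trans (m≤n+m (suc k) (card W)) (≤-reflexive (sym (size S)))))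
  heaviest-link {W} {e ∷ es} c S |es|≤c with heaviest e es
  ... | f , fs , π , heavy = f , fs , π , ≤-trans (≤-reflexive (sym (sumBy-↭ weight π)))
        (≤-trans heavy (*-monoˡ-≤ (weight f) (≤-trans (≤-reflexive (size S)) |es|≤c)))

  -- A cubic system of excess one has at most two vertices and three links. The heaviest link
  -- carries a third of the weight, and without it excess zero remains, so two thirds of the total
  -- weigh at least g.
  excess₁ : ∀ {W es} → 1 ≤ card W → System W es 1 → 3 * g ≤ 2 * total es
  excess₁ {W} {es} = Reduction.reduce 1 (λ t → 3 * g ≤ 2 * t) (λ a≤b h → ≤-trans h (*-monoʳ-≤ 2 a≤b))
    (λ {_} {e} {es} S 1≤ loop → loop₁ g (weight e) (total es) (head-loop-weight S loop) (excess₀ 1≤ (system-tail S)))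
    cubic-case _ W es ≤-refl
    where
    cubic-case : ∀ {W es} → System W es 1 → 1 ≤ card W → All Loopless es →
      (∀ v → v ∈ W → 3 ≤ deg v es) → 3 * g ≤ 2 * total es
    cubic-case {W} {es} S 1≤ _ cubic with heaviest-link 3 S (few-links 1 S cubic ⊕ ≤-refl {1})
    ... | f , fs , π , heavy = subst (λ t → 3 * g ≤ 2 * t) (sym (sumBy-↭ weight π))
          (heavy₁ g (weight f) (total fs) heavy (excess₀ 1≤ (system-tail (system-↭ π S))))

  -- The two links close up to a rainbow trail, and the remaining links still have excess zero on W:
  -- each half weighs at least g.
  parallel-links : ∀ {W e f es} → System W (e ∷ f ∷ es) 2 → 1 ≤ card W →
    (∃ λ e′ → ∃ λ f′ → src e′ ≡ src f′ × tgt e′ ≡ tgt f′ × SameContent e′ e × SameContent f′ f) →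
    2 * g ≤ total (e ∷ f ∷ es)
  parallel-links {e = e} {f} {es} S 1≤ (e′ , f′ , s≡ , t≡ , same , same′) with flip f′
  ... | f″ , sf″ , tf″ , same″ with join e′ f″ (trans t≡ (sym sf″))
  ...   | h , sh , th , weight≡ , uses≡ = begin
    2 * g                             ≡⟨ cong (g +_) (+-identityʳ g) ⟩
    g + g                             ≤⟨ g≤h ⊕ excess₀ 1≤ (system-tail (system-tail S)) ⟩
    weight h + total es               ≡⟨ cong (_+ total es) (trans weight≡ (cong₂ _+_ (same-weight same)
                                           (trans (same-weight same″) (same-weight same′)))) ⟩
    weight e + weight f + total es    ≡⟨ +-assoc (weight e) (weight f) (total es) ⟩
    total (e ∷ f ∷ es)                ∎
    where
    open ≤-Reasoning
    g≤h : g ≤ weight h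
    g≤h = loop-weight h (trans sh (trans s≡ (trans (sym tf″) (sym th)))) λ c → begin
      uses c h              ≡⟨ uses≡ c ⟩
      uses c e′ + uses c f″ ≡⟨ cong₂ _+_ (same-uses same c) (trans (same-uses same″ c) (same-uses same′ c)) ⟩
      uses c e + uses c f   ≤⟨ +-monoʳ-≤ (uses c e) (m≤m+n _ _) ⟩
      sumBy (uses c) (e ∷ f ∷ es) ≤⟨ rainbow S c ⟩
      1                     ∎

  deg≤length : ∀ v ts rs → All Loopless (ts ++ rs) → All (¬_ ∘ Touches v) rs → deg v (ts ++ rs) ≤ length ts
  deg≤length v [] rs l ¬t = ≤-reflexive (degree-no _ v rs ¬t)
  deg≤length v (e ∷ ts) rs (l ∷ ls) ¬t =
    ≤-trans (≤-reflexive (*-identityʳ (incidence v e))) (incidence-loopless v e l) ⊕ deg≤length v ts rs ls ¬t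

  -- A cubic system on four vertices: deleting the star of a vertex leaves excess zero, and the four
  -- stars cover every link twice.
  tetrahedron : ∀ {W es} → System W es 2 → card W ≡ 4 → All Loopless es → (∀ v → v ∈ W → 3 ≤ deg v es) →
    2 * g ≤ total es
  tetrahedron {W} {es} S |W|≡4 loopless cubic = *-cancelˡ-≤ 2 (conclude (total es) (begin
    2 * total es + 4 * g                                  ≡⟨ cong₂ _+_ (sym (handshake weight es)) (cong (_* g) (sym |W|≡4)) ⟩
    sum (λ v → degree weight v es) + card W * g           ≡⟨ cong (sum (λ v → degree weight v es) +_) (*-distribʳ-sum g (χ ∘ W)) ⟩
    sum (λ v → degree weight v es) + sum (λ v → χ (W v) * g) ≡⟨ sym (∑-distrib-+ (λ v → degree weight v es) (λ v → χ (W v) * g)) ⟩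
    sum (λ v → degree weight v es + χ (W v) * g)          ≤⟨ sum-mono pointwise ⟩
    sum (λ v → χ (W v) * total es)                        ≡⟨ sym (*-distribʳ-sum (total es) (χ ∘ W)) ⟩
    card W * total es                                     ≡⟨ cong (_* total es) |W|≡4 ⟩
    4 * total es                                          ∎))
    where
    open ≤-Reasoning
    conclude : ∀ t → 2 * t + 4 * g ≤ 4 * t → 2 * (2 * g) ≤ 2 * t
    conclude t h = linear 0 h (equation t g)
      where
      equation : ∀ t g → 2 * t + (2 * t + 4 * g) ≡ 2 * (2 * g) + 0 + 4 * t
      equation = solve-∀
    |es|≡6 : length es ≡ 6
    |es|≡6 = trans (size S) (cong (_+ 2) |W|≡4)
    -- The degrees sum to 12 on four vertices, so none exceeds three. Then each star has exactly
    -- three links, and the other three links on three vertices have excess zero.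
    deg≤3 : ∀ v → v ∈ W → deg v es ≤ 3
    deg≤3 v v∈W = ≮⇒≥ λ 3<d → <⇒≱ (n<1+n 12) (begin
      13                                        ≡⟨ cong (λ c → 1 + 3 * c) (sym |W|≡4) ⟩
      1 + 3 * card W                            ≡⟨ cong₂ _+_ (sym (sum-point v)) (*-distribˡ-sum 3 (χ ∘ W)) ⟩
      sum (λ u → ⟦ u ≟ v ⟧) + sum (λ u → 3 * χ (W u)) ≡⟨ sym (∑-distrib-+ (λ u → ⟦ u ≟ v ⟧) (λ u → 3 * χ (W u))) ⟩
      sum (λ u → ⟦ u ≟ v ⟧ + 3 * χ (W u))       ≤⟨ sum-mono (excess-at 3<d) ⟩
      sum (λ u → deg u es)                      ≡⟨ handshake (λ _ → 1) es ⟩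
      2 * sumBy (λ _ → 1) es                    ≡⟨ cong (2 *_) (trans (sumBy-1 es) |es|≡6) ⟩
      12                                        ∎)
      where
      excess-at : 3 < deg v es → ∀ u → ⟦ u ≟ v ⟧ + 3 * χ (W u) ≤ deg u es
      excess-at 3<d u with u ≟ v
      ... | yes refl rewrite v∈W = 3<d
      ... | no _ with u ∈? W
      ...   | yes u∈W rewrite u∈W = cubic u u∈W
      ...   | no u∉W rewrite χ-no W u∉W = z≤n
    pointwise : ∀ v → degree weight v es + χ (W v) * g ≤ χ (W v) * total es
    pointwise v with v ∈? W
    ... | no v∉W rewrite χ-no W v∉W = ≤-reflexive (trans (+-identityʳ _) (degree-outside weight v es v∉W (within S)))
    ... | yes v∈W rewrite v∈W with star v es
    ...   | ts , rs , π , t , ¬t = begin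
      degree weight v es + (g + 0)                 ≡⟨ cong₂ _+_ (sumBy-↭ _ π) (+-identityʳ g) ⟩
      degree weight v (ts ++ rs) + g               ≡⟨ cong (_+ g) (sumBy-++ _ ts rs) ⟩
      degree weight v ts + degree weight v rs + g  ≡⟨ cong (λ d → degree weight v ts + d + g) (degree-no weight v rs ¬t) ⟩
      degree weight v ts + 0 + g                   ≡⟨ cong (_+ g) (+-identityʳ _) ⟩
      degree weight v ts + g                       ≤⟨ degree≤sumBy weight v ts (++⁻ˡ ts loopless′) ⊕ excess₀ 1≤|W-v| rest ⟩
      total ts + total rs                          ≡⟨ sym (sumBy-++ weight ts rs) ⟩
      total (ts ++ rs)                             ≡⟨ sym (sumBy-↭ weight π) ⟩
      total es                                     ≡⟨ sym (+-identityʳ _) ⟩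
      total es + 0                                 ∎
      where
      loopless′ : All Loopless (ts ++ rs)
      loopless′ = All-resp-↭ π loopless
      S′ : System W (ts ++ rs) 2
      S′ = system-↭ π S
      |W-v|≡3 : card (W - v) ≡ 3
      |W-v|≡3 = suc-injective (trans (sym (card-remove W v∈W)) |W|≡4)
      1≤|W-v| : 1 ≤ card (W - v)
      1≤|W-v| = subst (1 ≤_) (sym |W-v|≡3) (s≤s z≤n)
      deg≡ : deg v es ≡ deg v (ts ++ rs)
      deg≡ = sumBy-↭ _ π
      |ts|≡3 : length ts ≡ 3
      |ts|≡3 = ≤-antisym
        (≤-trans (length≤deg v ts t) (≤-trans (m≤m+n _ _) (≤-trans (≤-reflexive (trans (sym (sumBy-++ (λ e → incidence v e * 1) ts rs)) (sym deg≡))) (deg≤3 v v∈W))))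
        (≤-trans (cubic v v∈W) (≤-trans (≤-reflexive deg≡) (deg≤length v ts rs loopless′ ¬t)))
      |rs|≡3 : length rs ≡ 3
      |rs|≡3 = +-cancelˡ-≡ 3 _ _ (trans (cong (_+ length rs) (sym |ts|≡3)) (trans (sym (length-++ ts)) (trans (sym (↭-length π)) |es|≡6)))
      rest : System (W - v) rs 0
      rest = system (within-remove (++⁻ʳ ts (within S′)) ¬t)
        (trans |rs|≡3 (sym (trans (+-identityʳ _) |W-v|≡3)))
        (λ c → ≤-trans (≤-trans (m≤n+m _ (sumBy (uses c) ts)) (≤-reflexive (sym (sumBy-++ (uses c) ts rs)))) (rainbow S′ c))

  -- Deleting the heaviest of up to six links would only yield 9g/5. Instead the links at one vertex
  -- are examined: two of them are parallel, or their other ends are distinct and W has exactly four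
  -- vertices.
  excess₂ : ∀ {W es} → 1 ≤ card W → System W es 2 → 2 * g ≤ total es
  excess₂ {W} {es} = Reduction.reduce 2 (2 * g ≤_) (λ a≤b h → ≤-trans h a≤b)
    (λ {_} {e} {es} S 1≤ loop → loop₂ g (weight e) (total es) (head-loop-weight S loop) (excess₁ 1≤ (system-tail S)))
    cubic-case _ W es ≤-refl
    where
    cubic-case : ∀ {W es} → System W es 2 → 1 ≤ card W → All Loopless es →
      (∀ v → v ∈ W → 3 ≤ deg v es) → 2 * g ≤ total es
    cubic-case {W} {es} S 1≤ loopless cubic with inhabited? W
    ... | inj₂ |W|≡0 = ⊥-elim (<⇒≱ 1≤ (≤-reflexive |W|≡0))
    ... | inj₁ (v , v∈W) with star v es
    ...   | ts , rs , π , t , ¬t = at-vertex ts π t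
      where
      few : ∀ ts → es ↭ ts ++ rs → length ts < 3 → ⊥
      few ts π |ts|<3 = <⇒≱ |ts|<3 (≤-trans (cubic v v∈W)
        (≤-trans (≤-reflexive (sumBy-↭ _ π)) (deg≤length v ts rs (All-resp-↭ π loopless) ¬t)))
      at-vertex : ∀ ts → es ↭ ts ++ rs → All (Touches v) ts → 2 * g ≤ total es
      at-vertex [] π _ = ⊥-elim (few [] π (s≤s z≤n))
      at-vertex (e ∷ []) π _ = ⊥-elim (few (e ∷ []) π (s≤s (s≤s z≤n)))
      at-vertex (e ∷ f ∷ []) π _ = ⊥-elim (few (e ∷ f ∷ []) π ≤-refl)
      at-vertex (e ∷ f ∷ h ∷ ts) π (te ∷ tf ∷ th ∷ _)
        with All-resp-↭ π loopless | All-resp-↭ π (within S)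
      ... | le ∷ lf ∷ lh ∷ _ | we ∷ wf ∷ wh ∷ _
        with orient-out e te le we | orient-out f tf lf wf | orient-out h th lh wh
      ... | e′ , se , e∈ , e≢ , same-e | f′ , sf , f∈ , f≢ , same-f | h′ , sh , h∈ , h≢ , same-h
        with tgt e′ ≟ tgt f′ | tgt e′ ≟ tgt h′ | tgt f′ ≟ tgt h′
      ... | yes e≡f | _ | _ = through π (e′ , f′ , trans se (sym sf) , e≡f , same-e , same-f)
        where
        through : ∀ {a b cs} → es ↭ a ∷ b ∷ cs → _ → 2 * g ≤ total es
        through π′ p = subst (2 * g ≤_) (sym (sumBy-↭ weight π′)) (parallel-links (system-↭ π′ S) 1≤ p)
      ... | no _ | yes e≡h | _ = subst (2 * g ≤_) (sym (sumBy-↭ weight π′))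
            (parallel-links (system-↭ π′ S) 1≤ (e′ , h′ , trans se (sym sh) , e≡h , same-e , same-h))
        where
        π′ : es ↭ e ∷ h ∷ f ∷ ts ++ rs
        π′ = ↭-trans π (↭-prep e (↭-swap f h ↭-refl))
      ... | no _ | no _ | yes f≡h = subst (2 * g ≤_) (sym (sumBy-↭ weight π′))
            (parallel-links (system-↭ π′ S) 1≤ (f′ , h′ , trans sf (sym sh) , f≡h , same-f , same-h))
        where
        π′ : es ↭ f ∷ h ∷ e ∷ ts ++ rs
        π′ = ↭-trans π (↭-trans (↭-swap e f ↭-refl) (↭-prep f (↭-swap e h ↭-refl)))
      ... | no e≢f | no e≢h | no f≢h = tetrahedron S (≤-antisym (few-links 2 S cubic) 4≤|W|) loopless cubic
        where
        4≤|W| : 4 ≤ card W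
        4≤|W| = ≤-trans (s≤s (card-triple (W - v) (∈-remove⁺ W e∈ e≢) (∈-remove⁺ W f∈ f≢) (∈-remove⁺ W h∈ h≢) e≢f e≢h f≢h))
          (≤-reflexive (sym (card-remove W v∈W)))

  -- At most six vertices and nine links: the heaviest link has a ninth of the weight and the rest
  -- has excess two, which gives 2g · 9/8 = 9g/4.
  excess₃ : ∀ {W es} → 1 ≤ card W → System W es 3 → 9 * g ≤ 4 * total es
  excess₃ {W} {es} = Reduction.reduce 3 (λ t → 9 * g ≤ 4 * t) (λ a≤b h → ≤-trans h (*-monoʳ-≤ 4 a≤b))
    (λ {_} {e} {es} S 1≤ loop → loop₃ g (weight e) (total es) (head-loop-weight S loop) (excess₂ 1≤ (system-tail S)))
    cubic-case _ W es ≤-refl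
    where
    cubic-case : ∀ {W es} → System W es 3 → 1 ≤ card W → All Loopless es →
      (∀ v → v ∈ W → 3 ≤ deg v es) → 9 * g ≤ 4 * total es
    cubic-case {W} {es} S 1≤ _ cubic with heaviest-link 9 S (few-links 3 S cubic ⊕ ≤-refl {3})
    ... | f , fs , π , heavy = subst (λ t → 9 * g ≤ 4 * t) (sym (sumBy-↭ weight π))
          (heavy₃ g (weight f) (total fs) heavy (excess₂ 1≤ (system-tail (system-↭ π S))))

-- Alive colours and critical vertex sets

sum-select : ∀ {n} (f : Fin n → ℕ) v → sum (λ u → f u * ⟦ u ≟ v ⟧) ≡ f v
sum-select f v = begin
  sum (λ u → f u * ⟦ u ≟ v ⟧) ≡⟨ sum-cong-≗ pointwise ⟩
  sum (λ u → f v * ⟦ u ≟ v ⟧) ≡⟨ sym (*-distribˡ-sum (f v) (λ u → ⟦ u ≟ v ⟧)) ⟩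
  f v * sum (λ u → ⟦ u ≟ v ⟧) ≡⟨ cong (f v *_) (sum-point v) ⟩
  f v * 1                     ≡⟨ *-identityʳ (f v) ⟩
  f v                         ∎
  where
  open ≡-Reasoning
  pointwise : ∀ u → f u * ⟦ u ≟ v ⟧ ≡ f v * ⟦ u ≟ v ⟧
  pointwise u with u ≟ v
  ... | yes refl = refl
  ... | no  _    = trans (*-zeroʳ (f u)) (sym (*-zeroʳ (f v)))

sum-unique : ∀ {n p} {P : Fin n → Set p} (P? : ∀ v → Dec (P v)) →
  (∀ {u v} → P u → P v → u ≡ v) → sum (λ v → ⟦ P? v ⟧) ≤ 1
sum-unique {n} P? unique with Fin.any? P?
... | no ∄    = ≤-trans (sum-mono (λ v → ≤-reflexive (⟦⟧-no (P? v) (λ p → ∄ (v , p)))))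
                  (≤-trans (≤-reflexive (trans (sum-const n 0) (*-zeroʳ n))) z≤n)
... | yes (v , p) = ≤-trans (sum-mono (λ u → ⟦⟧-mono (P? u) (u ≟ v) (λ q → unique q p))) (≤-reflexive (sum-point v))

module Alive {n : ℕ} (G : ColouredGraph n) where

  open Trails G using (Edge; col)

  end₁ end₂ : Edge → Fin n
  end₁ e = proj₁ (endpoint G e)
  end₂ e = proj₂ (endpoint G e)

  Incident : Fin n → Edge → Set
  Incident v e = v ≡ end₁ e ⊎ v ≡ end₂ e

  Inside : Subset n → Edge → Set
  Inside W e = end₁ e ∈ W × end₂ e ∈ W

  inside? : ∀ W e → Dec (Inside W e)
  inside? W e = (end₁ e ∈? W) ×-dec (end₂ e ∈? W)

  -- The edge set A is a parameter because the theory is applied both to the whole graph and to the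
  -- edges that survive the removal of those inside a chosen set.
  Has : Subset (m G) → Subset n → Fin n → Edge → Set
  Has A W i e = e ∈ A × col e ≡ i × Inside W e

  has? : ∀ A W i e → Dec (Has A W i e)
  has? A W i e = (e ∈? A) ×-dec (col e ≟ i) ×-dec inside? W e

  IsAlive : Subset (m G) → Subset n → Fin n → Set
  IsAlive A W i = ∃ (Has A W i)

  abstract
    alive? : ∀ A W i → Dec (IsAlive A W i)
    alive? A W i = Fin.any? (has? A W i)

  alive : Subset (m G) → Subset n → ℕ
  alive A W = sum (λ i → ⟦ alive? A W i ⟧)

  alive-mono : ∀ {A B} W → A ⊆ B → alive A W ≤ alive B W
  alive-mono {A} {B} W A⊆B = sum-mono (λ i → ⟦⟧-mono (alive? A W i) (alive? B W i)
    (λ (e , e∈A , rest) → e , A⊆B e∈A , rest))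

  alive≤n : ∀ A W → alive A W ≤ n
  alive≤n A W = ≤-trans (sum-mono (λ i → χ≤1 (does (alive? A W i)))) (≤-reflexive (trans (sum-const n 1) (*-identityʳ n)))

  alive⇒two : ∀ A W → 1 ≤ alive A W → 2 ≤ card W
  alive⇒two A W 1≤ with Fin.any? (alive? A W)
  ... | yes (i , e , _ , _ , u∈W , v∈W) = card-pair W u∈W v∈W (noLoops G e)
  ... | no ∄ = ⊥-elim (<⇒≱ 1≤ (≤-reflexive
        (trans (sum-cong-≗ (λ i → ⟦⟧-no (alive? A W i) (λ a → ∄ (i , a)))) (trans (sum-const n 0) (*-zeroʳ n)))))

  Kills : ∀ A W → Fin n → Fin n → Set
  Kills A W w i = IsAlive A W i × ¬ IsAlive A (W - w) i

  abstract
    kills? : ∀ A W w i → Dec (Kills A W w i)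
    kills? A W w i = alive? A W i ×-dec ¬? (alive? A (W - w) i)

  alive-remove : ∀ A W w → alive A W ≤ alive A (W - w) + sum (λ i → ⟦ kills? A W w i ⟧)
  alive-remove A W w = sum-+-mono pointwise
    where
    pointwise : ∀ i → ⟦ alive? A W i ⟧ ≤ ⟦ alive? A (W - w) i ⟧ + ⟦ kills? A W w i ⟧
    pointwise i with alive? A W i | alive? A (W - w) i
    ... | no _  | _     = z≤n
    ... | yes _ | yes _ = s≤s z≤n
    ... | yes a | no d  = ≤-reflexive (sym (⟦⟧-yes (kills? A W w i) (a , d)))

  kills-incident : ∀ {A W w i e} → Kills A W w i → Has A W i e → Incident w e
  kills-incident {A} {W} {w} {i} {e} (_ , dead) (e∈A , c , u∈W , v∈W) with w ≟ end₁ e | w ≟ end₂ e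
  ... | yes p | _     = inj₁ p
  ... | no _  | yes q = inj₂ q
  ... | no p  | no q  = ⊥-elim (dead (e , e∈A , c , ∈-remove⁺ W u∈W (p ∘ sym) , ∈-remove⁺ W v∈W (q ∘ sym)))

  Critical : Subset (m G) → Subset n → Set
  Critical A W = ∀ w → w ∈ W → alive A (W - w) + 2 ≤ alive A W

  Excess : Subset (m G) → ℕ → Subset n → Set
  Excess A e W = 1 ≤ card W × card W + e ≤ alive A W

  -- If deleting w lost at most one colour, `W - w` would be a smaller set of the same excess. It is
  -- nonempty, since an alive colour has an edge with two ends in W.
  minimal⇒critical : ∀ {A e W} → Excess A e W → (∀ W′ → card W′ < card W → ¬ Excess A e W′) → Critical A W
  minimal⇒critical {A} {e} {W} (1≤ , excess) least w w∈W = arithmetic (card W) (card (W - w)) |W|≡ excess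
    (≰⇒> (λ excess′ → least (W - w) (≤-reflexive (sym |W|≡)) (s≤s⁻¹ (subst (2 ≤_) |W|≡ 2≤|W|) , excess′)))
    where
    |W|≡ : card W ≡ suc (card (W - w))
    |W|≡ = card-remove W w∈W
    2≤|W| : 2 ≤ card W
    2≤|W| = alive⇒two A W (≤-trans 1≤ (≤-trans (m≤m+n _ _) excess))
    arithmetic : ∀ N M → N ≡ suc M → N + e ≤ alive A W → alive A (W - w) < M + e → alive A (W - w) + 2 ≤ alive A W
    arithmetic N M refl h h′ = ≤-trans (≤-reflexive (+-comm _ 2)) (≤-trans (s≤s h′) h)

  killed : ∀ A W → Subset n → Fin n → ℕ
  killed A W S i = sum (λ w → χ (S w) * ⟦ kills? A W w i ⟧)

  -- Double counting of the pairs of a vertex of S and a colour that it kills: each vertex kills at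
  -- least two colours.
  critical-count : ∀ {A W} S → S ⊆ W → Critical A W → 2 * card S ≤ sum (killed A W S)
  critical-count {A} {W} S S⊆W critical = begin
    2 * card S                                              ≡⟨ *-distribˡ-sum 2 (χ ∘ S) ⟩
    sum (λ w → 2 * χ (S w))                                 ≤⟨ sum-mono pointwise ⟩
    sum (λ w → χ (S w) * sum (λ i → ⟦ kills? A W w i ⟧))    ≡⟨ sum-cong-≗ (λ w → *-distribˡ-sum (χ (S w)) (λ i → ⟦ kills? A W w i ⟧)) ⟩
    sum (λ w → sum (λ i → χ (S w) * ⟦ kills? A W w i ⟧))    ≡⟨ ∑-comm (λ w i → χ (S w) * ⟦ kills? A W w i ⟧) ⟩
    sum (killed A W S)                                      ∎
    where
    open ≤-Reasoning
    pointwise : ∀ w → 2 * χ (S w) ≤ χ (S w) * sum (λ i → ⟦ kills? A W w i ⟧)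
    pointwise w with w ∈? S
    ... | no w∉S rewrite χ-no S w∉S = z≤n
    ... | yes w∈S rewrite w∈S = ≤-trans (+-cancelˡ-≤ (alive A (W - w)) _ _ (≤-trans (critical w (S⊆W w∈S)) (alive-remove A W w)))
          (≤-reflexive (sym (+-identityʳ _)))

  killed-dead : ∀ {A W i} S → ¬ IsAlive A W i → killed A W S i ≡ 0
  killed-dead {A} {W} {i} S dead = trans (sum-cong-≗ pointwise) (trans (sum-const n 0) (*-zeroʳ n))
    where
    pointwise : ∀ w → χ (S w) * ⟦ kills? A W w i ⟧ ≡ 0
    pointwise w = trans (cong (χ (S w) *_) (⟦⟧-no (kills? A W w i) (dead ∘ proj₁))) (*-zeroʳ (χ (S w)))

  -- A vertex that kills i lies on every edge of colour i inside W, in particular on e, so only the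
  -- two ends of e qualify.
  killed-alive : ∀ {A W i e} S → Has A W i e → killed A W S i ≤ χ (S (end₁ e)) + χ (S (end₂ e))
  killed-alive {A} {W} {i} {e} S has = ≤-trans (sum-mono pointwise) (≤-reflexive (trans
    (∑-distrib-+ (λ w → χ (S w) * ⟦ w ≟ end₁ e ⟧) (λ w → χ (S w) * ⟦ w ≟ end₂ e ⟧))
    (cong₂ _+_ (sum-select (χ ∘ S) (end₁ e)) (sum-select (χ ∘ S) (end₂ e)))))
    where
    pointwise : ∀ w → χ (S w) * ⟦ kills? A W w i ⟧ ≤ χ (S w) * ⟦ w ≟ end₁ e ⟧ + χ (S w) * ⟦ w ≟ end₂ e ⟧
    pointwise w with kills? A W w i
    ... | no _ = ≤-trans (≤-reflexive (*-zeroʳ (χ (S w)))) z≤n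
    ... | yes k with kills-incident {A} {W} k has
    ...   | inj₁ p = ≤-trans (≤-reflexive (cong (χ (S w) *_) (sym (⟦⟧-yes (w ≟ end₁ e) p)))) (m≤m+n _ _)
    ...   | inj₂ q = ≤-trans (≤-reflexive (cong (χ (S w) *_) (sym (⟦⟧-yes (w ≟ end₂ e) q)))) (m≤n+m _ (χ (S w) * ⟦ w ≟ end₁ e ⟧))

  Multi : Subset (m G) → Subset n → Fin n → Set
  Multi A W i = ∃ λ e → ∃ λ f → e ≢ f × Has A W i e × Has A W i f

  abstract
    multi? : ∀ A W i → Dec (Multi A W i)
    multi? A W i = Fin.any? (λ e → Fin.any? (λ f → ¬? (e ≟ f) ×-dec has? A W i e ×-dec has? A W i f))

  multi : Subset (m G) → Subset n → ℕ
  multi A W = sum (λ i → ⟦ multi? A W i ⟧)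

  two-ends : ∀ {e u v} → u ≢ v → Incident u e → Incident v e → Joins G e u v
  two-ends u≢v (inj₁ p) (inj₁ q) = ⊥-elim (u≢v (trans p (sym q)))
  two-ends u≢v (inj₁ p) (inj₂ q) = inj₁ (sym p , sym q)
  two-ends u≢v (inj₂ p) (inj₁ q) = inj₂ (sym q , sym p)
  two-ends u≢v (inj₂ p) (inj₂ q) = ⊥-elim (u≢v (trans p (sym q)))

  killed-2 : ∀ {A W i} S → killed A W S i ≤ 2 * ⟦ alive? A W i ⟧
  killed-2 {A} {W} {i} S with alive? A W i
  ... | no dead     = ≤-reflexive (killed-dead S dead)
  ... | yes (e , h) = ≤-trans (killed-alive S h) (χ≤1 (S (end₁ e)) ⊕ χ≤1 (S (end₂ e)))

  -- Exc collects the colours all of whose edges may lie inside S.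
  touching-count : ∀ {A W p} {Exc : Fin n → Set p} (exc? : ∀ i → Dec (Exc i)) S → S ⊆ W → Critical A W →
    (∀ e → e ∈ A → ¬ Exc (col e) → ¬ Inside S e) →
    2 * card S ≤ alive A W + sum (λ i → ⟦ exc? i ⟧)
  touching-count {A} {W} exc? S S⊆W critical outside = ≤-trans (critical-count S S⊆W critical) (sum-+-mono pointwise)
    where
    pointwise : ∀ i → killed A W S i ≤ ⟦ alive? A W i ⟧ + ⟦ exc? i ⟧
    pointwise i with alive? A W i
    ... | no dead = ≤-trans (≤-reflexive (killed-dead S dead)) z≤n
    ... | yes (e , h@(e∈A , c , _)) with exc? i
    ...   | yes _ = ≤-trans (killed-alive S h) (χ≤1 (S (end₁ e)) ⊕ χ≤1 (S (end₂ e)))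
    -- An edge not inside S has at most one end in S, hence at most one killer there.
    ...   | no ¬exc = ≤-trans (killed-alive S h) at-most-one
      where
      at-most-one : χ (S (end₁ e)) + χ (S (end₂ e)) ≤ 1
      at-most-one with end₁ e ∈? S
      ... | no u∉S rewrite χ-no S u∉S = χ≤1 (S (end₂ e))
      ... | yes u∈S with end₂ e ∈? S
      ...   | no v∉S rewrite χ-no S v∉S = ≤-trans (≤-reflexive (+-identityʳ _)) (χ≤1 (S (end₁ e)))
      ...   | yes v∈S = ⊥-elim (outside e e∈A (λ exc → ¬exc (subst _ c exc)) (u∈S , v∈S))

  module SimpleGraph (simple : Simple G) where

    no-parallel : ∀ {e f u v} → e ≢ f → col e ≡ col f → u ≢ v →
      Incident u e → Incident v e → Incident u f → Incident v f → ⊥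
    no-parallel {e} {f} e≢f same u≢v ue ve uf vf = simple e f e≢f same
      (case two-ends u≢v ue ve of λ where
        (inj₁ (p , q)) → subst₂ (Joins G f) (sym p) (sym q) (two-ends u≢v uf vf)
        (inj₂ (p , q)) → subst₂ (Joins G f) (sym p) (sym q) (two-ends (u≢v ∘ sym) vf uf))

    -- Two edges of one colour are not parallel and so share at most one vertex, the only possible
    -- killer of that colour. Any other alive colour has at most two killers. Against the two kills
    -- per vertex of a critical set, this makes repeated colours rare.
    multi-count : ∀ {A W} → Critical A W → 2 * card W + multi A W ≤ 2 * alive A W
    multi-count {A} {W} critical = begin
      2 * card W + multi A W                                 ≤⟨ +-monoˡ-≤ _ (critical-count W id critical) ⟩
      sum (killed A W W) + multi A W                         ≡⟨ sym (∑-distrib-+ (killed A W W) (λ i → ⟦ multi? A W i ⟧)) ⟩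
      sum (λ i → killed A W W i + ⟦ multi? A W i ⟧)          ≤⟨ sum-mono pointwise ⟩
      sum (λ i → 2 * ⟦ alive? A W i ⟧)                       ≡⟨ sym (*-distribˡ-sum 2 (λ i → ⟦ alive? A W i ⟧)) ⟩
      2 * alive A W                                          ∎
      where
      open ≤-Reasoning
      pointwise : ∀ i → killed A W W i + ⟦ multi? A W i ⟧ ≤ 2 * ⟦ alive? A W i ⟧
      pointwise i with multi? A W i
      ... | no _ = ≤-trans (≤-reflexive (+-identityʳ _)) (killed-2 W)
      ... | yes (e , f , e≢f , he , hf) = ≤-trans (at-most-one ⊕ ≤-refl)
            (*-monoʳ-≤ 2 (≤-reflexive (sym (⟦⟧-yes (alive? A W i) (e , he)))))
        where
        inc : ∀ {w e} → Kills A W w i → Has A W i e → Incident w e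
        inc = kills-incident {A} {W}
        unique : ∀ {u v} → Kills A W u i → Kills A W v i → u ≡ v
        unique {u} {v} ku kv with u ≟ v
        ... | yes u≡v = u≡v
        ... | no  u≢v = ⊥-elim (no-parallel e≢f (trans (proj₁ (proj₂ he)) (sym (proj₁ (proj₂ hf)))) u≢v
              (inc ku he) (inc kv he) (inc ku hf) (inc kv hf))
        at-most-one : killed A W W i ≤ 1
        at-most-one = ≤-trans (sum-mono (λ w → ≤-trans (*-monoˡ-≤ ⟦ kills? A W w i ⟧ (χ≤1 (W w))) (≤-reflexive (+-identityʳ _))))
          (sum-unique (λ w → kills? A W w i) unique)

-- From alive colours to bounds on vertex sets

module AliveBounds {n : ℕ} (G : ColouredGraph n) (g : ℕ)
  (girth : ∀ k → RainbowCycle G k → g ≤ cycleLength k) where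

  open Trails G
  open WeightedGraphs G g girth
  open ExcessBounds G g girth
  open Alive G
  open ListAll using ([]; _∷_)

  edge-link : Edge → Link
  edge-link e = link {src = end₁ e} {end₂ e} (inj₁ (refl , refl) ∷ []) (s≤s z≤n)

  module _ (A : Subset (m G)) (W : Subset n) where

    representatives : ∀ {k} → (Fin k → Fin n) → List Link
    representatives {zero}  f = []
    representatives {suc k} f with alive? A W (f zero)
    ... | yes (e , _) = edge-link e ∷ representatives (f ∘ suc)
    ... | no _        = representatives (f ∘ suc)

    representatives-length : ∀ {k} (f : Fin k → Fin n) → length (representatives f) ≡ sum (λ i → ⟦ alive? A W (f i) ⟧)
    representatives-length {zero}  f = refl
    representatives-length {suc k} f with alive? A W (f zero)
    ... | yes _ = cong suc (representatives-length (f ∘ suc))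
    ... | no _  = representatives-length (f ∘ suc)

    representatives-within : ∀ {k} (f : Fin k → Fin n) → All (λ e → Within W e × weight e ≡ 1) (representatives f)
    representatives-within {zero}  f = []
    representatives-within {suc k} f with alive? A W (f zero)
    ... | yes (e , _ , _ , inside) = (inside , refl) ∷ representatives-within (f ∘ suc)
    ... | no _  = representatives-within (f ∘ suc)

    representatives-uses : ∀ {k} c (f : Fin k → Fin n) → sumBy (uses c) (representatives f) ≤ sum (λ i → ⟦ f i ≟ c ⟧)
    representatives-uses {zero}  c f = z≤n
    representatives-uses {suc k} c f with alive? A W (f zero)
    ... | yes (e , _ , col≡ , _) = ≤-trans (≤-reflexive (+-identityʳ _))
            (⟦⟧-mono (col e ≟ c) (f zero ≟ c) (trans (sym col≡))) ⊕ representatives-uses c (f ∘ suc)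
    ... | no _  = ≤-trans (representatives-uses c (f ∘ suc)) (m≤n+m _ ⟦ f zero ≟ c ⟧)

  sumBy-take : ∀ μ k es → sumBy μ (take k es) ≤ sumBy μ es
  sumBy-take μ zero    es       = z≤n
  sumBy-take μ (suc k) []       = z≤n
  sumBy-take μ (suc k) (e ∷ es) = +-monoʳ-≤ (μ e) (sumBy-take μ k es)

  total-unit : ∀ es → All (λ e → weight e ≡ 1) es → total es ≡ length es
  total-unit []       []       = refl
  total-unit (e ∷ es) (p ∷ ps) = cong₂ _+_ p (total-unit es ps)

  -- One edge per alive colour; surplus edges are cut off to make the excess exactly k. All links
  -- have weight one, so the weight bounds become bounds on |W|.
  rainbow-system : ∀ A W k → card W + k ≤ alive A W → ∃ λ es → System W es k × total es ≡ card W + k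
  rainbow-system A W k enough = es , system (ListAll.map proj₁ links) |es|≡ rainbow , trans (total-unit es (ListAll.map proj₂ links)) |es|≡
    where
    all : List Link
    all = representatives A W id
    es : List Link
    es = take (card W + k) all
    links : All (λ e → Within W e × weight e ≡ 1) es
    links = take⁺ (card W + k) (representatives-within A W id)
    |es|≡ : length es ≡ card W + k
    |es|≡ = trans (length-take (card W + k) all)
      (m≤n⇒m⊓n≡m (≤-trans enough (≤-reflexive (sym (representatives-length A W id)))))
    rainbow : ∀ c → sumBy (uses c) es ≤ 1
    rainbow c = ≤-trans (sumBy-take (uses c) (card W + k) all)
      (≤-trans (representatives-uses A W c id) (≤-reflexive (sum-point c)))

  girth₀ : ∀ {A W} → Excess A 0 W → g ≤ card W
  girth₀ {A} {W} (1≤ , excess) with rainbow-system A W 0 excess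
  ... | es , S , total≡ = ≤-trans (excess₀ 1≤ S) (≤-reflexive (trans total≡ (+-identityʳ _)))

  girth₁ : ∀ {A W} → Excess A 1 W → 3 * g ≤ 2 * (card W + 1)
  girth₁ {A} {W} (1≤ , excess) with rainbow-system A W 1 excess
  ... | es , S , total≡ = ≤-trans (excess₁ 1≤ S) (≤-reflexive (cong (2 *_) total≡))

  girth₂ : ∀ {A W} → Excess A 2 W → 2 * g ≤ card W + 2
  girth₂ {A} {W} (1≤ , excess) with rainbow-system A W 2 excess
  ... | es , S , total≡ = ≤-trans (excess₂ 1≤ S) (≤-reflexive total≡)

  girth₃ : ∀ {A W} → Excess A 3 W → 9 * g ≤ 4 * (card W + 3)
  girth₃ {A} {W} (1≤ , excess) with rainbow-system A W 3 excess
  ... | es , S , total≡ = ≤-trans (excess₃ 1≤ S) (≤-reflexive (cong (4 *_) total≡))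

-- Closed sets when every vertex has two successors

card-strict : ∀ {n} (X Y : Subset n) {v} → X ⊆ Y → v ∈ Y → v ∉ X → card X < card Y
card-strict X Y {v} X⊆Y v∈Y v∉X = ≤-trans
  (s≤s (card-mono X (Y - v) (λ u∈X → ∈-remove⁺ Y (X⊆Y u∈X) (λ u≡v → v∉X (subst (_∈ X) u≡v u∈X)))))
  (≤-reflexive (sym (card-remove Y v∈Y)))

sum-inhabited : ∀ {n p} {P : Fin n → Set p} (P? : ∀ v → Dec (P v)) → ∃ P → 1 ≤ sum (λ v → ⟦ P? v ⟧)
sum-inhabited P? (v , p) = ≤-trans (≤-reflexive (sym (⟦⟧-yes (P? v) p))) (term≤sum (λ u → ⟦ P? u ⟧) v)

-- An injection from X to Y in relational form: pairs are counted by rows and by columns, and no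
-- image has to be chosen.
relation-count : ∀ {n r} {R : Fin n → Fin n → Set r} (R? : ∀ x p → Dec (R x p)) (X Y : Subset n) →
  (∀ {x} → x ∈ X → ∃ λ p → R x p) → (∀ {x p} → R x p → p ∈ Y) → (∀ {x y p} → R x p → R y p → x ≡ y) →
  card X ≤ card Y
relation-count {n} R? X Y total into unique = begin
  card X                              ≤⟨ sum-mono rows ⟩
  sum (λ x → sum (λ p → ⟦ R? x p ⟧))  ≡⟨ ∑-comm (λ x p → ⟦ R? x p ⟧) ⟩
  sum (λ p → sum (λ x → ⟦ R? x p ⟧))  ≤⟨ sum-mono columns ⟩
  card Y                              ∎
  where
  open ≤-Reasoning
  rows : ∀ x → χ (X x) ≤ sum (λ p → ⟦ R? x p ⟧)
  rows x with x ∈? X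
  ... | no x∉X rewrite χ-no X x∉X = z≤n
  ... | yes x∈X rewrite x∈X = sum-inhabited (R? x) (total x∈X)
  columns : ∀ p → sum (λ x → ⟦ R? x p ⟧) ≤ χ (Y p)
  columns p with p ∈? Y
  ... | yes p∈Y rewrite p∈Y = sum-unique (λ x → R? x p) unique
  ... | no p∉Y = ≤-trans (sum-mono (λ x → ≤-reflexive (⟦⟧-no (R? x p) (p∉Y ∘ into))))
        (≤-trans (≤-reflexive (trans (sum-const n 0) (*-zeroʳ n))) z≤n)

two-successors-arithmetic : ∀ a b C Z D X → a ≤ b * C → a ≤ b * Z → Z ≤ 2 * D → D + C ≤ X → 3 * a ≤ 2 * (b * X)
two-successors-arithmetic a b C Z D X h₁ h₂ h₃ h₄ =
  linear 0 (2 ⊛ h₁ ⊕ h₂ ⊕ b ⊛ h₃ ⊕ 2 ⊛ (b ⊛ h₄)) (solve (a ∷ b ∷ C ∷ Z ∷ D ∷ X ∷ []))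

-- In a minimal closed set C every vertex has exactly one successor in C. Following the other
-- successor from the vertices of C, at most half of a minimal invariant set lies in C.
module TwoSuccessors {n : ℕ} (X : Subset n) (s₁ s₂ : Fin n → Fin n)
  (s₁∈X : ∀ {x} → x ∈ X → s₁ x ∈ X) (s₂∈X : ∀ {x} → x ∈ X → s₂ x ∈ X) (s₁≢s₂ : ∀ {x} → x ∈ X → s₁ x ≢ s₂ x)
  (a b : ℕ) (closed-bound : ∀ C → C ⊆ X → 1 ≤ card C → (∀ {c} → c ∈ C → s₁ c ∈ C ⊎ s₂ c ∈ C) → a ≤ b * card C) where

  Closed : Subset n → Set
  Closed C = ∀ {c} → c ∈ C → s₁ c ∈ C ⊎ s₂ c ∈ C

  Closed-in-X : Subset n → Set
  Closed-in-X C = C ⊆ X × 1 ≤ card C × Closed C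

  module _ (C : Subset n) (C⊆X : C ⊆ X) (1≤|C| : 1 ≤ card C) (closed : Closed C)
    (least : ∀ D → card D < card C → ¬ Closed-in-X D) where

    Forced : Fin n → Fin n → Set
    Forced x p = p ∈ C - x × ¬ (s₁ p ∈ C - x ⊎ s₂ p ∈ C - x)

    forced? : ∀ x p → Dec (Forced x p)
    forced? x p = (p ∈? C - x) ×-dec ¬? ((s₁ p ∈? C - x) ⊎-dec (s₂ p ∈? C - x))

    only : ∀ {x v} → v ∈ C → v ∉ C - x → v ≡ x
    only {x} {v} v∈C v∉ = decidable-stable (v ≟ x) (λ v≢x → v∉ (∈-remove⁺ C v∈C v≢x))

    -- By minimality every x in C is the sole successor in C of some p, since otherwise `C - x`
    -- would be closed. Such a p determines x and is never c, which has two successors in C, so C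
    -- would inject into `C - c`.
    not-both : ∀ {c} → c ∈ C → ¬ (s₁ c ∈ C × s₂ c ∈ C)
    not-both {c} c∈C (s₁∈ , s₂∈) = <⇒≱ (≤-reflexive (sym (card-remove C c∈C)))
      (relation-count forced? C (C - c) some-forced forced-in forced-once)
      where
      some-forced : ∀ {x} → x ∈ C → ∃ λ p → Forced x p
      some-forced {x} x∈C with Fin.any? (forced? x)
      ... | yes p = p
      ... | no ∄ = ⊥-elim (least (C - x) (≤-reflexive (sym |C|≡))
              ((λ v∈ → C⊆X (proj₁ (∈-remove⁻ C v∈))) , s≤s⁻¹ (subst (2 ≤_) |C|≡ (card-pair C s₁∈ s₂∈ (s₁≢s₂ (C⊆X c∈C)))) , closed′))
        where
        |C|≡ : card C ≡ suc (card (C - x))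
        |C|≡ = card-remove C x∈C
        closed′ : Closed (C - x)
        closed′ {p} p∈ with (s₁ p ∈? C - x) ⊎-dec (s₂ p ∈? C - x)
        ... | yes s = s
        ... | no ¬s = ⊥-elim (∄ (p , p∈ , ¬s))
      forced-in : ∀ {x p} → Forced x p → p ∈ C - c
      forced-in {x} {p} (p∈ , ¬s) = ∈-remove⁺ C (proj₁ (∈-remove⁻ C p∈)) λ { refl →
        s₁≢s₂ (C⊆X c∈C) (trans (only s₁∈ (¬s ∘ inj₁)) (sym (only s₂∈ (¬s ∘ inj₂)))) }
      forced-once : ∀ {x y p} → Forced x p → Forced y p → x ≡ y
      forced-once {x} {y} {p} (p∈ , ¬s) (_ , ¬s′) with closed (proj₁ (∈-remove⁻ C p∈))
      ... | inj₁ s = trans (sym (only s (¬s ∘ inj₁))) (only s (¬s′ ∘ inj₁))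
      ... | inj₂ s = trans (sym (only s (¬s ∘ inj₂))) (only s (¬s′ ∘ inj₂))

    Escape : Fin n → Fin n → Set
    Escape x y = (y ≡ s₁ x ⊎ y ≡ s₂ x) × (x ∈ C → y ∈ X → y ∉ C)

    escape-exists : ∀ x → ∃ (Escape x)
    escape-exists x with x ∈? C | s₁ x ∈? C
    ... | yes x∈C | yes s∈C = s₂ x , inj₂ refl , λ _ _ s′∈C → not-both x∈C (s∈C , s′∈C)
    ... | _       | no  s∉C = s₁ x , inj₁ refl , λ _ _ → s∉C
    ... | no x∉C  | yes _   = s₁ x , inj₁ refl , λ x∈C → ⊥-elim (x∉C x∈C)

    f : Fin n → Fin n
    f x = proj₁ (escape-exists x)

    f∈X : ∀ {x} → x ∈ X → f x ∈ X
    f∈X {x} x∈X with proj₁ (proj₂ (escape-exists x))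
    ... | inj₁ eq = subst (_∈ X) (sym eq) (s₁∈X x∈X)
    ... | inj₂ eq = subst (_∈ X) (sym eq) (s₂∈X x∈X)

    f-escapes : ∀ {x} → x ∈ C → f x ∉ C
    f-escapes {x} x∈C = proj₂ (proj₂ (escape-exists x)) x∈C (f∈X (C⊆X x∈C))

    Invariant : Subset n → Set
    Invariant Z = Z ⊆ X × 1 ≤ card Z × (∀ {z} → z ∈ Z → f z ∈ Z)

    module _ (Z : Subset n) (Z⊆X : Z ⊆ X) (1≤|Z| : 1 ≤ card Z) (invariant : ∀ {z} → z ∈ Z → f z ∈ Z)
      (least′ : ∀ Y → card Y < card Z → ¬ Invariant Y) where

      Maps : Fin n → Fin n → Set
      Maps x p = p ∈ Z ∖ C × f p ≡ x

      maps? : ∀ x p → Dec (Maps x p)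
      maps? x p = (p ∈? Z ∖ C) ×-dec (f p ≟ x)

      -- If no point of Z were mapped to x, `Z - x` would be a smaller invariant set. The preimage
      -- avoids C because `f` maps C out of C, while x lies in C.
      preimage : ∀ {x} → x ∈ Z ∩ C → ∃ λ p → Maps x p
      preimage {x} x∈ with ∈-∩⁻ Z C x∈
      ... | x∈Z , x∈C with Fin.any? (maps? x)
      ...   | yes p = p
      ...   | no ∄ = ⊥-elim (least′ (Z - x) (≤-reflexive (sym (card-remove Z x∈Z)))
                ((λ v∈ → Z⊆X (proj₁ (∈-remove⁻ Z v∈))) , card-witness (Z - x) (∈-remove⁺ Z (invariant x∈Z) fx≢x) , stays))
        where
        fx≢x : f x ≢ x
        fx≢x fx≡x = f-escapes x∈C (subst (_∈ C) (sym fx≡x) x∈C)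
        stays : ∀ {z} → z ∈ Z - x → f z ∈ Z - x
        stays {z} z∈ = ∈-remove⁺ Z (invariant z∈Z) λ fz≡x →
          ∄ (z , ∈-∖⁺ Z C z∈Z (λ z∈C → f-escapes z∈C (subst (_∈ C) (sym fz≡x) x∈C)) , fz≡x)
          where
          z∈Z : z ∈ Z
          z∈Z = proj₁ (∈-remove⁻ Z z∈)

      half : card Z ≤ 2 * card (Z ∖ C)
      half = ≤-trans (≤-reflexive (card-split Z C)) (≤-trans (+-monoˡ-≤ (card (Z ∖ C))
        (relation-count maps? (Z ∩ C) (Z ∖ C) preimage proj₁ (λ p q → trans (sym (proj₂ p)) (proj₂ q))))
        (≤-reflexive (cong (card (Z ∖ C) +_) (sym (+-identityʳ _)))))

      outside : card (Z ∖ C) + card C ≤ card X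
      outside = ≤-trans (card-mono (Z ∖ C) (X ∖ C) (λ v∈ → ∈-∖⁺ X C (Z⊆X (proj₁ (∈-∖⁻ Z C v∈))) (proj₂ (∈-∖⁻ Z C v∈)))
          ⊕ card-mono C (X ∩ C) (λ v∈ → ∈-∩⁺ X C (C⊆X v∈) v∈))
        (≤-reflexive (trans (+-comm (card (X ∖ C)) (card (X ∩ C))) (sym (card-split X C))))

      conclusion : 3 * a ≤ 2 * (b * card X)
      conclusion = two-successors-arithmetic a b (card C) (card Z) (card (Z ∖ C)) (card X)
        (closed-bound C C⊆X 1≤|C| closed) (closed-bound Z Z⊆X 1≤|Z| closed-Z) half outside
        where
        closed-Z : Closed Z
        closed-Z {z} z∈Z with proj₁ (proj₂ (escape-exists z))
        ... | inj₁ eq = inj₁ (subst (_∈ Z) eq (invariant z∈Z))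
        ... | inj₂ eq = inj₂ (subst (_∈ Z) eq (invariant z∈Z))

  -- C and the part of Z outside C are disjoint in X, with at least a/b and a/(2b) elements. The
  -- ratio a/b is g for single arcs and g/2 when each step may cost an extra vertex.
  two-successors : 1 ≤ card X → 3 * a ≤ 2 * (b * card X)
  two-successors 1≤|X| = ≮⇒≥ λ bad → minimal Closed-in-X
    (λ C (C⊆X , 1≤|C| , closed) least → minimal (Invariant C C⊆X 1≤|C| closed least)
      (λ Z (Z⊆X , 1≤|Z| , invariant) least′ →
        <⇒≱ bad (conclusion C C⊆X 1≤|C| closed least Z Z⊆X 1≤|Z| invariant least′))
      X (id , 1≤|X| , f∈X C C⊆X 1≤|C| closed least))
    X (id , 1≤|X| , inj₁ ∘ s₁∈X)

-- Digraphs of outdegree three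

growth-thin : ∀ g k B ∂ → 3 * k + 1 ≤ B → g ≤ B → 2 ≤ ∂ → 6 * (1 + k) + g + 2 ≤ 3 * (B + ∂)
growth-thin g k B ∂ h₁ h₂ h₃ = linear 0 (2 ⊛ h₁ ⊕ h₂ ⊕ 3 ⊛ h₃) (solve (g ∷ k ∷ B ∷ ∂ ∷ []))

growth-fat : ∀ k B ∂ → 3 * k + 1 ≤ B → 3 ≤ ∂ → 3 * (1 + k) + 1 ≤ B + ∂
growth-fat k B ∂ h₁ h₂ = linear 0 (h₁ ⊕ h₂) (solve (k ∷ B ∷ ∂ ∷ []))

growth-late : ∀ g k B ∂ → 6 * k + g + 2 ≤ 3 * B → 2 ≤ ∂ → 6 * (1 + k) + g + 2 ≤ 3 * (B + ∂)
growth-late g k B ∂ h₁ h₂ = linear 0 (h₁ ⊕ 3 ⊛ h₂) (solve (g ∷ k ∷ B ∷ ∂ ∷ []))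

closed-fat : ∀ n k → 4 * n + 64 ≤ 9 * (1 + k) → 3 * k + 1 ≤ n → ⊥
closed-fat n k h₁ h₂ = <⇒≱ (linear {1} {0} (n + 57) (h₁ ⊕ 3 ⊛ h₂) (solve (n ∷ k ∷ []))) ≤-refl

closed-thin : ∀ n k → 4 * n + 64 ≤ 9 * (1 + k) → 6 * k + (1 + k) + 2 ≤ 3 * n → ⊥
closed-thin n k h₁ h₂ = <⇒≱ (linear {1} {0} (n + 411) (7 ⊛ h₁ ⊕ 9 ⊛ h₂) (solve (n ∷ k ∷ []))) ≤-refl

ball-large : ∀ n g X B → 4 * n + 64 ≤ 9 * g → 3 * g ≤ 2 * X → g ≤ B → B + X ≤ n → ⊥
ball-large n g X B h₁ h₂ h₃ h₄ =
  <⇒≱ (linear {1} {0} (2 * n + 319) (5 ⊛ h₁ ⊕ 9 ⊛ h₂ ⊕ 18 ⊛ h₃ ⊕ 18 ⊛ h₄) (solve (n ∷ g ∷ X ∷ B ∷ []))) ≤-refl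

reach-step : ∀ n i X B → 3 * i + 1 ≤ B → B + X ≤ n → 3 * (1 + i) + X ≤ n + 2
reach-step n i X B h₁ h₂ = linear 0 (h₁ ⊕ h₂) (solve (n ∷ i ∷ X ∷ B ∷ []))

near : ∀ n g k X → 4 * n + 64 ≤ 9 * g → g ≤ k + 2 → 3 * k + X ≤ n + 2 → ⊥
near n g k X h₁ h₂ h₃ = <⇒≱ (linear {1} {0} (n + 3 * X + 39) (h₁ ⊕ 9 ⊛ h₂ ⊕ 3 ⊛ h₃) (solve (n ∷ g ∷ k ∷ X ∷ []))) ≤-refl

through-fat : ∀ n k j X → 4 * n + 64 ≤ 9 * (k + 3 + j) → 3 * k + X ≤ n + 2 → 3 * j + 1 ≤ X → ⊥
through-fat n k j X h₁ h₂ h₃ = <⇒≱ (linear {1} {0} (n + 33) (h₁ ⊕ 3 ⊛ h₂ ⊕ 3 ⊛ h₃) (solve (n ∷ k ∷ j ∷ X ∷ []))) ≤-refl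

through-thin : ∀ n k j X → 4 * n + 64 ≤ 9 * (k + 3 + j) → 3 * k + X ≤ n + 2 → X ≤ n →
  6 * j + (k + 3 + j) + 2 ≤ 3 * X → ⊥
through-thin n k j X h₁ h₂ h₃ h₄ =
  <⇒≱ (linear {1} {0} (n + 267) (7 ⊛ h₁ ⊕ 18 ⊛ h₂ ⊕ 9 ⊛ h₃ ⊕ 9 ⊛ h₄) (solve (n ∷ k ∷ j ∷ X ∷ []))) ≤-refl

-- Digraphs in which every vertex has three out-neighbours and every closed set has at least g vertices.
-- Balls grow by three vertices per step as long as they are smaller than g, since a set with at most two
-- boundary vertices contains a closed set. A minimal set X with at most one boundary vertex b keeps the
-- growth at two or more inside X, and outside X balls are too small to slow down.
module ThreeOut {n : ℕ} (o : Fin 3 → Fin n → Fin n) (o-distinct : ∀ v {i j} → o i v ≡ o j v → i ≡ j)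
  (o-irrefl : ∀ i v → o i v ≢ v) (g : ℕ)
  (closed-bound : ∀ C → 1 ≤ card C → (∀ {c} → c ∈ C → ∃ λ i → o i c ∈ C) → g ≤ card C)
  (large : 4 * n + 64 ≤ 9 * g) where

  Boundary : Subset n → Fin n → Set
  Boundary X v = v ∉ X × ∃ λ u → u ∈ X × ∃ λ i → o i u ≡ v

  abstract
    boundary? : ∀ X v → Dec (Boundary X v)
    boundary? X v = ¬? (v ∈? X) ×-dec Fin.any? (λ u → (u ∈? X) ×-dec Fin.any? (λ i → o i u ≟ v))

  ∂ : Subset n → Subset n
  ∂ X = comprehension (boundary? X)

  ∈-∂⁺ : ∀ X {u} i → u ∈ X → o i u ∉ X → o i u ∈ ∂ X
  ∈-∂⁺ X {u} i u∈X o∉X = ∈-comp⁺ (boundary? X) (o∉X , u , u∈X , i , refl)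

  ∈-∂⁻ : ∀ X {v} → v ∈ ∂ X → Boundary X v
  ∈-∂⁻ X = ∈-comp⁻ (boundary? X)

  0≢1 : ∀ v → o zero v ≢ o (suc zero) v
  0≢1 v eq = case o-distinct v eq of λ ()

  0≢2 : ∀ v → o zero v ≢ o (suc (suc zero)) v
  0≢2 v eq = case o-distinct v eq of λ ()

  1≢2 : ∀ v → o (suc zero) v ≢ o (suc (suc zero)) v
  1≢2 v eq = case o-distinct v eq of λ ()

  -- A vertex with all three out-neighbours outside X would put three vertices into the boundary;
  -- hence X is closed.
  small-boundary₂ : ∀ X → 1 ≤ card X → card (∂ X) ≤ 2 → g ≤ card X
  small-boundary₂ X 1≤ ∂≤2 = closed-bound X 1≤ stays
    where
    stays : ∀ {c} → c ∈ X → ∃ λ i → o i c ∈ X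
    stays {c} c∈X with Fin.any? (λ i → o i c ∈? X)
    ... | yes stay = stay
    ... | no leave = ⊥-elim (<⇒≱ (card-triple (∂ X) (exit zero) (exit (suc zero)) (exit (suc (suc zero)))
            (0≢1 c) (0≢2 c) (1≢2 c)) ∂≤2)
      where
      exit : ∀ i → o i c ∈ ∂ X
      exit i = ∈-∂⁺ X i c∈X (λ o∈X → leave (i , o∈X))

  -- At most one of the three arcs at a vertex of X leaves X, so two successors remain inside and
  -- `TwoSuccessors` applies.
  small-boundary₁ : ∀ X → 1 ≤ card X → card (∂ X) ≤ 1 → 3 * g ≤ 2 * card X
  small-boundary₁ X 1≤ ∂≤1 = subst (λ c → 3 * g ≤ 2 * c) (+-identityʳ (card X))
    (TwoSuccessors.two-successors X (λ x → s (proj₁ (choice x)) x) (λ x → s (proj₁ (proj₂ (choice x))) x)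
      (λ {x} x∈X → proj₁ (proj₂ (proj₂ (choice x)) x∈X)) (λ {x} x∈X → proj₁ (proj₂ (proj₂ (proj₂ (choice x)) x∈X)))
      (λ {x} x∈X → proj₂ (proj₂ (proj₂ (proj₂ (choice x)) x∈X)))
      g 1 (λ C C⊆X 1≤|C| closed → ≤-trans (closed-bound C 1≤|C| (λ {c} c∈C → stays C (closed c∈C))) (≤-reflexive (sym (+-identityʳ _)))) 1≤)
    where
    s : Fin 3 → Fin n → Fin n
    s i x = o i x
    exits : ∀ {x i j} → x ∈ X → o i x ≢ o j x → o i x ∉ X → o j x ∉ X → ⊥
    exits x∈X i≢j i∉ j∉ = <⇒≱ (card-pair (∂ X) (∈-∂⁺ X _ x∈X i∉) (∈-∂⁺ X _ x∈X j∉) i≢j) ∂≤1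
    choice : ∀ x → ∃ λ i → ∃ λ j → x ∈ X → o i x ∈ X × o j x ∈ X × o i x ≢ o j x
    choice x with o zero x ∈? X | o (suc zero) x ∈? X
    ... | yes p | yes q = zero , suc zero , λ _ → p , q , 0≢1 x
    ... | yes p | no  q = zero , suc (suc zero) , λ x∈X → p ,
            decidable-stable (_ ∈? X) (exits x∈X (1≢2 x) q) , 0≢2 x
    ... | no  p | _     = suc zero , suc (suc zero) , λ x∈X →
            decidable-stable (_ ∈? X) (exits x∈X (0≢1 x) p) , decidable-stable (_ ∈? X) (exits x∈X (0≢2 x) p) , 1≢2 x
    stays : ∀ {x} C → s (proj₁ (choice x)) x ∈ C ⊎ s (proj₁ (proj₂ (choice x))) x ∈ C → ∃ λ i → o i x ∈ C
    stays C (inj₁ p) = _ , p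
    stays C (inj₂ p) = _ , p

  ball : Fin n → ℕ → Subset n
  ball x zero    = singleton x
  ball x (suc i) = ball x i ∪ ∂ (ball x i)

  centre∈ball : ∀ x i → x ∈ ball x i
  centre∈ball x zero    = ∈-singleton⁺ x
  centre∈ball x (suc i) = ∈-∪⁺ˡ (ball x i) (∂ (ball x i)) (centre∈ball x i)

  card-ball : ∀ x i → card (ball x (suc i)) ≡ card (ball x i) + card (∂ (ball x i))
  card-ball x i = trans (sum-cong-≗ pointwise) (∑-distrib-+ (χ ∘ ball x i) (χ ∘ ∂ (ball x i)))
    where
    pointwise : ∀ v → χ (ball x i v ∨ ∂ (ball x i) v) ≡ χ (ball x i v) + χ (∂ (ball x i) v)
    pointwise v with v ∈? ball x i
    ... | yes v∈ rewrite χ-no (∂ (ball x i)) (λ v∈∂ → proj₁ (∈-∂⁻ (ball x i) v∈∂) v∈) | v∈ = refl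
    ... | no  v∉ with ball x i v
    ...   | true  = ⊥-elim (v∉ refl)
    ...   | false = refl

  -- A surrogate for a directed path from x to v, remembered only as a vertex set. Every vertex but
  -- v can move on, so an arc or path from v back to x makes the set closed.
  Path : Fin n → Fin n → ℕ → Set
  Path x v l = ∃ λ W → card W ≤ l × x ∈ W × v ∈ W × (∀ {w} → w ∈ W → w ≢ v → ∃ λ i → o i w ∈ W)

  path : ∀ x i {v} → v ∈ ball x i → Path x v (suc i)
  path x zero {v} v∈ with ∈-singleton⁻ v x v∈
  ... | refl = singleton x , ≤-reflexive (card-singleton x) , ∈-singleton⁺ x , ∈-singleton⁺ x ,
        λ {w} w∈ w≢x → ⊥-elim (w≢x (∈-singleton⁻ w x w∈))
  path x (suc i) {v} v∈ with ∈-∪⁻ (ball x i) (∂ (ball x i)) v∈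
  ... | inj₁ v∈ball with path x i v∈ball
  ...   | W , |W|≤ , rest = W , m≤n⇒m≤1+n |W|≤ , rest
  path x (suc i) {v} v∈ | inj₂ v∈∂ with ∈-∂⁻ (ball x i) v∈∂
  ... | _ , u , u∈ball , j , refl with path x i u∈ball
  ...   | W , |W|≤ , x∈W , u∈W , moves = W ∪ singleton v ,
          ≤-trans (card-∪ W (singleton v)) (≤-trans (|W|≤ ⊕ ≤-reflexive (card-singleton v)) (≤-reflexive (+-comm (suc i) 1))) ,
          ∈-∪⁺ˡ W (singleton v) x∈W , v∈W′ , moves′
    where
    v∈W′ : v ∈ W ∪ singleton v
    v∈W′ = ∈-∪⁺ʳ W (singleton v) (∈-singleton⁺ v)
    moves′ : ∀ {w} → w ∈ W ∪ singleton v → w ≢ v → ∃ λ i → o i w ∈ W ∪ singleton v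
    moves′ {w} w∈ w≢v with ∈-∪⁻ W (singleton v) w∈ | w ≟ u
    ... | inj₂ w∈v | _ = ⊥-elim (w≢v (∈-singleton⁻ w v w∈v))
    ... | inj₁ w∈W | yes refl = j , v∈W′
    ... | inj₁ w∈W | no w≢u with moves w∈W w≢u
    ...   | i′ , o∈W = i′ , ∈-∪⁺ˡ W (singleton v) o∈W

  return-bound : ∀ x i {p j} → p ∈ ball x i → o j p ≡ x → g ≤ suc i
  return-bound x i {p} {j} p∈ back with path x i p∈
  ... | W , |W|≤ , x∈W , p∈W , moves = ≤-trans (closed-bound W (card-witness W x∈W) closed) |W|≤
    where
    closed : ∀ {w} → w ∈ W → ∃ λ i → o i w ∈ W
    closed {w} w∈W with w ≟ p
    ... | yes refl = j , subst (_∈ W) (sym back) x∈W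
    ... | no  w≢p  = moves w∈W w≢p

  -- The union of a path from x to y and one back is closed. The two ends are counted twice, which
  -- costs only an additive constant.
  round-trip-bound : ∀ x y i j → x ≢ y → y ∈ ball x i → x ∈ ball y j → g ≤ suc i + suc j
  round-trip-bound x y i j x≢y y∈ x∈ with path x i y∈ | path y j x∈
  ... | W , |W|≤ , x∈W , y∈W , moves | W′ , |W′|≤ , y∈W′ , x∈W′ , moves′ =
    ≤-trans (closed-bound (W ∪ W′) (card-witness (W ∪ W′) (∈-∪⁺ˡ W W′ x∈W)) closed) (≤-trans (card-∪ W W′) (|W|≤ ⊕ |W′|≤))
    where
    inˡ : ∀ {w} → (∃ λ i → o i w ∈ W) → ∃ λ i → o i w ∈ W ∪ W′
    inˡ (i , o∈) = i , ∈-∪⁺ˡ W W′ o∈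
    inʳ : ∀ {w} → (∃ λ i → o i w ∈ W′) → ∃ λ i → o i w ∈ W ∪ W′
    inʳ (i , o∈) = i , ∈-∪⁺ʳ W W′ o∈
    closed : ∀ {w} → w ∈ W ∪ W′ → ∃ λ i → o i w ∈ W ∪ W′
    closed {w} w∈ with ∈-∪⁻ W W′ w∈ | w ≟ x | w ≟ y
    ... | _ | yes refl | _ = inˡ (moves x∈W x≢y)
    ... | _ | no _ | yes refl = inʳ (moves′ y∈W′ (x≢y ∘ sym))
    ... | inj₁ w∈W | no _ | no w≢y = inˡ (moves w∈W w≢y)
    ... | inj₂ w∈W′ | no w≢x | no _ = inʳ (moves′ w∈W′ w≢x)

  -- The ball gains three vertices per step until a boundary of size two occurs. By then it is
  -- closed and has at least g vertices; twice the bound 3k + 1 plus the bound g gives 6k + g + 2 ≤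
  -- 3|B|, an estimate that gains of two preserve.
  growth : ∀ x k → (∀ i → i < k → 2 ≤ card (∂ (ball x i))) →
    3 * k + 1 ≤ card (ball x k) ⊎ 6 * k + g + 2 ≤ 3 * card (ball x k)
  growth x zero _ = inj₁ (≤-reflexive (sym (card-singleton x)))
  growth x (suc k) wide with growth x k (λ i i<k → wide i (m<n⇒m<1+n i<k)) | wide k (n<1+n k)
  ... | inj₂ late | ∂≥2 rewrite card-ball x k = inj₂ (growth-late g k (card (ball x k)) _ late ∂≥2)
  ... | inj₁ fat  | ∂≥2 with card (∂ (ball x k)) ≤? 2
  ...   | no ∂≰2 rewrite card-ball x k = inj₁ (growth-fat k (card (ball x k)) _ fat (≰⇒> ∂≰2))
  ...   | yes ∂≤2 with small-boundary₂ (ball x k) (card-witness (ball x k) (centre∈ball x k)) ∂≤2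
  ...     | g≤ rewrite card-ball x k = inj₂ (growth-thin g k (card (ball x k)) _ fat g≤ ∂≥2)

  Thin : Subset n → Set
  Thin X = 1 ≤ card X × card (∂ X) ≤ 1

  module _ (X : Subset n) (1≤|X| : 1 ≤ card X) (∂X≤1 : card (∂ X) ≤ 1) (least : ∀ Y → card Y < card X → ¬ Thin Y) where

    wide-ball : ∀ x i {p} → ball x i ⊆ X → p ∈ X → p ∉ ball x i → 2 ≤ card (∂ (ball x i))
    wide-ball x i ball⊆X p∈X p∉ball = ≰⇒> λ ∂≤1 → least (ball x i) (card-strict (ball x i) X ball⊆X p∈X p∉ball)
      (card-witness (ball x i) (centre∈ball x i) , ∂≤1)

    -- Each x in X has an in-neighbour p in X, or else `X - x` would be thin too. Balls around x
    -- stay in X and miss p below radius g - 1, so they are proper subsets with boundary at least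
    -- two, and at radius g - 1 they are too large.
    no-boundary : (∀ {v} → v ∉ ∂ X) → ⊥
    no-boundary ∂X=∅ with inhabited? X
    ... | inj₂ |X|≡0 = <⇒≱ 1≤|X| (≤-reflexive |X|≡0)
    ... | inj₁ (x , x∈X) with Fin.any? (λ p → (p ∈? X) ×-dec Fin.any? (λ j → o j p ≟ x))
    ...   | no ∄ = least (X - x) (≤-reflexive (sym (card-remove X x∈X)))
            (card-witness (X - x) (∈-remove⁺ X (out zero x∈X) (o-irrefl zero x)) , ≤-trans (≤-reflexive ∂≡0) z≤n)
      where
      out : ∀ i {u} → u ∈ X → o i u ∈ X
      out i {u} u∈X = decidable-stable (o i u ∈? X) (λ o∉X → ∂X=∅ (∈-∂⁺ X i u∈X o∉X))
      ∂≡0 : card (∂ (X - x)) ≡ 0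
      ∂≡0 with inhabited? (∂ (X - x))
      ... | inj₂ ≡0 = ≡0
      ... | inj₁ (v , v∈∂) with ∈-∂⁻ (X - x) v∈∂
      ...   | v∉ , u , u∈ , j , refl = ⊥-elim (v∉ (∈-remove⁺ X (out j u∈X) (λ eq → ∄ (u , u∈X , j , eq))))
        where
        u∈X : u ∈ X
        u∈X = proj₁ (∈-remove⁻ X u∈)
    ...   | yes (p , p∈X , j , back) = by-size g refl
      where
      ball⊆X : ∀ i → ball x i ⊆ X
      ball⊆X zero {v} v∈ = subst (_∈ X) (sym (∈-singleton⁻ v x v∈)) x∈X
      ball⊆X (suc i) {v} v∈ with ∈-∪⁻ (ball x i) (∂ (ball x i)) v∈
      ... | inj₁ v∈ball = ball⊆X i v∈ball
      ... | inj₂ v∈∂ with ∈-∂⁻ (ball x i) v∈∂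
      ...   | _ , u , u∈ , k , refl = decidable-stable (o k u ∈? X) (λ o∉X → ∂X=∅ (∈-∂⁺ X k (ball⊆X i u∈) o∉X))
      by-size : ∀ h → h ≡ g → ⊥
      by-size zero refl = <⇒≱ {0} {0} (≤-trans (s≤s z≤n) (≤-trans (m≤n+m 64 (4 * n)) large)) z≤n
      by-size (suc k) refl with growth x k (λ i i<k → wide-ball x i (ball⊆X i) p∈X
                                 (λ p∈ → <⇒≱ (s≤s i<k) (return-bound x i p∈ back)))
      ... | inj₁ fat  = closed-fat n k large (≤-trans fat (card≤n (ball x k)))
      ... | inj₂ thin = closed-thin n k large (≤-trans thin (*-monoʳ-≤ 3 (card≤n (ball x k))))

    module _ (b : Fin n) (b∈∂X : b ∈ ∂ X) where

      b∉X : b ∉ X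
      b∉X = proj₁ (∈-∂⁻ X b∈∂X)

      ∂X-unique : ∀ {v} → v ∈ ∂ X → v ≡ b
      ∂X-unique {v} v∈ = decidable-stable (v ≟ b) (λ v≢b → <⇒≱ (card-pair (∂ X) v∈ b∈∂X v≢b) ∂X≤1)

      3g≤2|X| : 3 * g ≤ 2 * card X
      3g≤2|X| = small-boundary₁ X 1≤|X| ∂X≤1

      -- The inequality remembers that the ball of radius k - 1 around b is disjoint from X and has
      -- at least 3(k - 1) + 1 vertices.
      Reached : Set
      Reached = ∃ λ k → ∃ λ x → x ∈ X × x ∈ ball b k × 3 * k + card X ≤ n + 2

      Apart : ℕ → Set
      Apart i = (∀ {v} → v ∈ ball b i → v ∉ X) × 3 * i + 1 ≤ card (ball b i)

      -- While the ball around b is disjoint from X it gains three vertices per step: a boundary of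
      -- size two would mean g vertices beside the 3g/2 of X, more than n.
      approach : ∀ i → Reached ⊎ Apart i
      approach zero = inj₂ ((λ {v} v∈ v∈X → b∉X (subst (_∈ X) (∈-singleton⁻ v b v∈) v∈X)) , ≤-reflexive (sym (card-singleton b)))
      approach (suc i) with approach i
      ... | inj₁ reached = inj₁ reached
      ... | inj₂ (apart , fat) with inhabited? (ball b (suc i) ∩ X)
      ...   | inj₁ (x , x∈) = inj₁ (suc i , x , proj₂ (∈-∩⁻ (ball b (suc i)) X x∈) , proj₁ (∈-∩⁻ (ball b (suc i)) X x∈) ,
                reach-step n i (card X) (card (ball b i)) fat (card-disjoint (ball b i) X apart))
      ...   | inj₂ ≡0 = inj₂ ((λ v∈ v∈X → <⇒≱ (card-witness (ball b (suc i) ∩ X) (∈-∩⁺ (ball b (suc i)) X v∈ v∈X)) (≤-reflexive ≡0)) ,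
                subst (3 * suc i + 1 ≤_) (sym (card-ball b i)) (growth-fat i (card (ball b i)) _ fat (≰⇒> λ ∂≤2 →
                  ball-large n g (card X) (card (ball b i)) large 3g≤2|X|
                    (small-boundary₂ (ball b i) (card-witness (ball b i) (centre∈ball b i)) ∂≤2)
                    (card-disjoint (ball b i) X apart))))

      -- Every arc leaving X leads to b, and b reaches some x in X within k steps. Balls around x
      -- stay in X as long as they miss b, and they do so while a round trip would be shorter than
      -- g. Missing also an in-neighbour of b, they are proper subsets of the minimal X and have
      -- boundary at least two.
      cut-vertex : ⊥
      cut-vertex with approach n
      -- A ball of radius n that is still apart from X would have 3n + 1 vertices.
      ... | inj₂ (_ , fat) = <⇒≱ (≤-trans (s≤s (m≤n*m n 3)) (≤-trans (≤-reflexive (+-comm 1 (3 * n))) fat)) (card≤n (ball b n))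
      ... | inj₁ (k , x , x∈X , x∈ball , near-X) with k + 3 ≤? g
      ...   | no k+3≰g = near n g k (card X) large (s≤s⁻¹ (≤-trans (≰⇒> k+3≰g) (≤-reflexive (+-suc k 2)))) near-X
      ...   | yes k+3≤g = cases (growth x j λ i i<j → wide i i<j)
        where
        j : ℕ
        -- The largest radius at which a round trip, counted as (k + 1) + (j + 1) vertices, is still
        -- below g.
        j = g ∸ (k + 3)
        g≡ : k + 3 + j ≡ g
        g≡ = m+[n∸m]≡n k+3≤g
        b∉ball : ∀ i → i ≤ j → b ∉ ball x i
        b∉ball i i≤j b∈ = <⇒≱ (begin
          suc (suc k + suc i) ≡⟨ +-comm 1 (suc k + suc i) ⟩
          suc k + suc i + 1   ≡⟨ rearrange k i ⟩
          k + 3 + i           ≤⟨ +-monoʳ-≤ (k + 3) i≤j ⟩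
          k + 3 + j           ≡⟨ g≡ ⟩
          g                   ∎)
          (round-trip-bound b x k i (λ { refl → b∉X x∈X }) x∈ball b∈)
          where
          open ≤-Reasoning
          rearrange : ∀ k i → suc k + suc i + 1 ≡ k + 3 + i
          rearrange = solve-∀
        ball⊆X : ∀ i → i ≤ j → ball x i ⊆ X
        ball⊆X zero _ {v} v∈ = subst (_∈ X) (sym (∈-singleton⁻ v x v∈)) x∈X
        ball⊆X (suc i) i<j {v} v∈ with ∈-∪⁻ (ball x i) (∂ (ball x i)) v∈
        ... | inj₁ v∈ball = ball⊆X i (<⇒≤ i<j) v∈ball
        ... | inj₂ v∈∂ with ∈-∂⁻ (ball x i) v∈∂
        ...   | _ , u , u∈ , l , refl = decidable-stable (o l u ∈? X) λ o∉X →
                b∉ball (suc i) i<j (subst (_∈ ball x (suc i)) (∂X-unique (∈-∂⁺ X l (ball⊆X i (<⇒≤ i<j) u∈) o∉X)) v∈)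
        wide : ∀ i → i < j → 2 ≤ card (∂ (ball x i))
        wide i i<j with ∈-∂⁻ X b∈∂X
        ... | _ , u , u∈X , l , refl with u ∈? ball x i
        ...   | no u∉ball = wide-ball x i (ball⊆X i (<⇒≤ i<j)) u∈X u∉ball
        ...   | yes u∈ball = ⊥-elim (b∉ball (suc i) i<j
                (∈-∪⁺ʳ (ball x i) (∂ (ball x i)) (∈-∂⁺ (ball x i) l u∈ball (b∉ball i (<⇒≤ i<j)))))
        large′ : 4 * n + 64 ≤ 9 * (k + 3 + j)
        large′ = subst (λ h → 4 * n + 64 ≤ 9 * h) (sym g≡) large
        |ball|≤|X| : card (ball x j) ≤ card X
        |ball|≤|X| = card-mono (ball x j) X (ball⊆X j ≤-refl)
        cases : 3 * j + 1 ≤ card (ball x j) ⊎ 6 * j + g + 2 ≤ 3 * card (ball x j) → ⊥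
        cases (inj₁ fat)  = through-fat n k j (card X) large′ near-X (≤-trans fat |ball|≤|X|)
        -- Together with 3k ≤ n - |X| this gives 7g ≤ 2n + |X| ≤ 3n up to constants, and 3/7 is
        -- below 4/9.
        cases (inj₂ thin) = through-thin n k j (card X) large′ near-X (card≤n X)
          (≤-trans (subst (λ h → 6 * j + h + 2 ≤ 3 * card (ball x j)) (sym g≡) thin) (*-monoʳ-≤ 3 |ball|≤|X|))

  contradiction-from-large-girth : 1 ≤ n → ⊥
  contradiction-from-large-girth 1≤n = minimal Thin refute full (subst (1 ≤_) (sym (card-full n)) 1≤n , ≤-trans ∂full≤0 z≤n)
    where
    ∂full≤0 : card (∂ full) ≤ 0
    ∂full≤0 with inhabited? (∂ full)
    ... | inj₂ ≡0 = ≤-reflexive ≡0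
    ... | inj₁ (v , v∈) = ⊥-elim (proj₁ (∈-∂⁻ full v∈) refl)
    refute : ∀ X → Thin X → (∀ Y → card Y < card X → ¬ Thin Y) → ⊥
    refute X (1≤|X| , ∂≤1) least with inhabited? (∂ X)
    ... | inj₁ (b , b∈) = cut-vertex X 1≤|X| ∂≤1 least b b∈
    ... | inj₂ ≡0 = no-boundary X 1≤|X| ∂≤1 least (λ v∈ → <⇒≱ (card-witness (∂ X) v∈) (≤-reflexive ≡0))

-- Numerical endgames and digraphs of outdegree two

excess₃-arithmetic : ∀ n g W al → 4 * n + 64 ≤ 9 * g → 9 * g ≤ 4 * (W + 3) → W + 3 ≤ al → al ≤ n → ⊥
excess₃-arithmetic n g W al h₁ h₂ h₃ h₄ =
  <⇒≱ (linear {1} {0} 63 (h₁ ⊕ h₂ ⊕ 4 ⊛ h₃ ⊕ 4 ⊛ h₄) (solve (n ∷ g ∷ W ∷ al ∷ []))) ≤-refl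

multi-arithmetic : ∀ k W M al → 2 * W + M ≤ 2 * al → al ≤ W + k → M ≤ 2 * k
multi-arithmetic k W M al h₁ h₂ = linear 0 (h₁ ⊕ 2 ⊛ h₂) (solve (k ∷ W ∷ M ∷ al ∷ []))

cover-arithmetic : ∀ k m Q Y W M al → 2 * Q ≤ al + M → al ≤ W + k → M ≤ m → W ≡ Q + Y → W ≤ 2 * Y + (k + m)
cover-arithmetic k m Q Y W M al h₁ h₂ h₃ refl = linear 0 (h₁ ⊕ h₂ ⊕ h₃) (solve (k ∷ m ∷ Q ∷ Y ∷ M ∷ al ∷ []))

excess₂-arithmetic : ∀ n g W W′ Y → 4 * n + 64 ≤ 9 * g → 2 * g ≤ W + 2 → g ≤ W′ → W′ ≤ 2 * Y + 6 → Y + W ≤ n → ⊥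
excess₂-arithmetic n g W W′ Y h₁ h₂ h₃ h₄ h₅ =
  <⇒≱ (linear {1} {0} (2 * n + 229) (5 ⊛ h₁ ⊕ 18 ⊛ h₂ ⊕ 9 ⊛ h₃ ⊕ 9 ⊛ h₄ ⊕ 18 ⊛ h₅) (solve (n ∷ g ∷ W ∷ W′ ∷ Y ∷ []))) ≤-refl

excess₁-arithmetic : ∀ n g W W′ Y → 4 * n + 64 ≤ 9 * g → 3 * g ≤ 2 * (W + 1) → 3 * g ≤ 2 * (W′ + 1) →
  W′ ≤ 2 * Y + 3 → Y + W ≤ n → ⊥
excess₁-arithmetic n g W W′ Y h₁ h₂ h₃ h₄ h₅ =
  <⇒≱ (linear {1} {0} 51 (h₁ ⊕ 2 ⊛ h₂ ⊕ h₃ ⊕ 2 ⊛ h₄ ⊕ 4 ⊛ h₅) (solve (n ∷ g ∷ W ∷ W′ ∷ Y ∷ []))) ≤-refl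

two-out-arithmetic : ∀ n g W Y T → 4 * n + 64 ≤ 9 * g → 3 * g ≤ 2 * (W + 1) → 3 * g ≤ 2 * (2 * T) → T ≤ Y + 2 → Y + W ≤ n → ⊥
two-out-arithmetic n g W Y T h₁ h₂ h₃ h₄ h₅ =
  <⇒≱ (linear {1} {0} 51 (h₁ ⊕ 2 ⊛ h₂ ⊕ h₃ ⊕ 4 ⊛ h₄ ⊕ 4 ⊛ h₅) (solve (n ∷ g ∷ W ∷ Y ∷ T ∷ []))) ≤-refl

-- When no arc joins two vertices outside T, either t or one of its out-neighbours has both its
-- out-neighbours in T. This `mid` gives t two successors in T for one extra vertex.
record TwoSteps {n : ℕ} (T : Subset n) (Arc : Fin n → Fin n → Set) (t : Fin n) : Set where
  field
    {mid s₁ s₂} : Fin n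
    s₁∈T        : s₁ ∈ T
    s₂∈T        : s₂ ∈ T
    s₁≢s₂       : s₁ ≢ s₂
    start       : mid ≡ t ⊎ Arc t mid
    arc₁        : Arc mid s₁
    arc₂        : Arc mid s₂

module TwoOut {n : ℕ} (T : Subset n) (out : Fin 2 → Fin n → Fin n)
  (out-distinct : ∀ v → out zero v ≢ out (suc zero) v) (out∈T : ∀ {v} i → v ∉ T → out i v ∈ T)
  (g : ℕ) (closed-bound : ∀ C → 1 ≤ card C → (∀ {c} → c ∈ C → ∃ λ i → out i c ∈ C) → g ≤ card C) where

  Arc : Fin n → Fin n → Set
  Arc u v = ∃ λ i → out i u ≡ v

  steps : ∀ t → TwoSteps T Arc t
  steps t = choose (out zero t ∈? T) (out (suc zero) t ∈? T)
    where
    through : ∀ i → out i t ∉ T → TwoSteps T Arc t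
    through i ∉T = record { s₁∈T = out∈T zero ∉T ; s₂∈T = out∈T (suc zero) ∉T ; s₁≢s₂ = out-distinct (out i t)
      ; start = inj₂ (i , refl) ; arc₁ = zero , refl ; arc₂ = suc zero , refl }
    choose : Dec (out zero t ∈ T) → Dec (out (suc zero) t ∈ T) → TwoSteps T Arc t
    choose (yes p) (yes q) = record { s₁∈T = p ; s₂∈T = q ; s₁≢s₂ = out-distinct t
      ; start = inj₁ refl ; arc₁ = zero , refl ; arc₂ = suc zero , refl }
    choose (no p)  _       = through zero p
    choose (yes _) (no q)  = through (suc zero) q

  open module Step t = TwoSteps (steps t)

  -- Adding the intermediate vertices, at most one for each element of C, makes C closed in the
  -- original digraph.
  step-bound : ∀ C → C ⊆ T → 1 ≤ card C → (∀ {c} → c ∈ C → s₁ c ∈ C ⊎ s₂ c ∈ C) → g ≤ 2 * card C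
  step-bound C C⊆T 1≤|C| closed = ≤-trans (closed-bound (C ∪ M) (≤-trans 1≤|C| (card-mono C (C ∪ M) (∈-∪⁺ˡ C M))) closed′)
    (≤-trans (card-∪ C M) (≤-trans (+-monoʳ-≤ (card C) |M|≤|C|) (≤-reflexive (cong (card C +_) (sym (+-identityʳ _))))))
    where
    Mid : Fin n → Fin n → Set
    Mid v c = c ∈ C × mid c ≡ v
    mid? : ∀ v c → Dec (Mid v c)
    mid? v c = (c ∈? C) ×-dec (mid c ≟ v)
    M : Subset n
    M = comprehension (λ v → Fin.any? (mid? v))
    M⁻ : ∀ {v} → v ∈ M → ∃ (Mid v)
    M⁻ {v} = ∈-comp⁻ (λ v → Fin.any? (mid? v)) {v}
    mid∈M : ∀ {c} → c ∈ C → mid c ∈ M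
    mid∈M {c} c∈C = ∈-comp⁺ (λ v → Fin.any? (mid? v)) {mid c} (c , c∈C , refl)
    |M|≤|C| : card M ≤ card C
    |M|≤|C| = relation-count mid? M C (λ {v} → M⁻ {v}) proj₁ (λ p q → trans (sym (proj₂ p)) (proj₂ q))
    arc : ∀ {u v} → Arc u v → v ∈ C ∪ M → ∃ λ i → out i u ∈ C ∪ M
    arc (i , eq) v∈ = i , subst (_∈ C ∪ M) (sym eq) v∈
    from-mid : ∀ {c} → c ∈ C → ∃ λ i → out i (mid c) ∈ C ∪ M
    from-mid {c} c∈C with closed c∈C
    ... | inj₁ s∈C = arc (arc₁ c) (∈-∪⁺ˡ C M s∈C)
    ... | inj₂ s∈C = arc (arc₂ c) (∈-∪⁺ˡ C M s∈C)
    from-C : ∀ {c} → c ∈ C → ∃ λ i → out i c ∈ C ∪ M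
    from-C {c} c∈C with start c
    ... | inj₂ a = arc a (∈-∪⁺ʳ C M (mid∈M c∈C))
    ... | inj₁ mid≡c = subst (λ u → ∃ λ i → out i u ∈ C ∪ M) mid≡c (from-mid c∈C)
    closed′ : ∀ {c} → c ∈ C ∪ M → ∃ λ i → out i c ∈ C ∪ M
    closed′ {c} c∈ with ∈-∪⁻ C M {c} c∈
    ... | inj₁ c∈C = from-C c∈C
    ... | inj₂ c∈M with M⁻ {c} c∈M
    ...   | c′ , c′∈C , refl = from-mid c′∈C

  two-step-bound : Fin n → 3 * g ≤ 2 * (2 * card T)
  two-step-bound x = TwoSuccessors.two-successors T s₁ s₂ (λ {x} _ → s₁∈T x) (λ {x} _ → s₂∈T x) (λ {x} _ → s₁≢s₂ x)
    g 2 step-bound (card-witness T (s₁∈T x))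

-- Elimination of positive excess

module LargeGirth {n : ℕ} (G : ColouredGraph n) (simple : Simple G) (1≤n : 1 ≤ n) (g : ℕ)
  (girth : ∀ k → RainbowCycle G k → g ≤ cycleLength k) (large : 4 * n + 64 ≤ 9 * g)
  (class : Fin n → Fin 3 → Fin (m G)) (class-distinct : ∀ c {i j} → class c i ≡ class c j → i ≡ j)
  (class-colour : ∀ c i → colour G (class c i) ≡ c) where

  open Trails G using (Edge; col)
  open Alive G
  open SimpleGraph simple
  open AliveBounds G g girth

  no-excess : ∀ A W e → ¬ Excess A (suc e) W → alive A W ≤ card W + e
  no-excess A W e ¬excess = ≮⇒≥ λ more → ¬excess
    (≤-trans (s≤s z≤n) (alive⇒two A W (≤-trans (s≤s z≤n) more)) , ≤-trans (≤-reflexive (+-suc (card W) e)) more)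

  excess-full : ∀ A → (∀ i → ∃ λ e → e ∈ A × col e ≡ i) → Excess A 0 full
  excess-full A occurs = subst (1 ≤_) (sym (card-full n)) 1≤n , (begin
    card (full {n}) + 0              ≡⟨ +-identityʳ _ ⟩
    card (full {n})                  ≤⟨ sum-mono (λ i → ≤-reflexive (sym (⟦⟧-yes (alive? A full i) (is-alive i)))) ⟩
    alive A full                     ∎)
    where
    open ≤-Reasoning
    is-alive : ∀ i → IsAlive A full i
    is-alive i with occurs i
    ... | e , e∈A , c = e , e∈A , c , refl , refl

  alive≤+2 : ∀ W → alive full W ≤ card W + 2
  alive≤+2 W = no-excess full W 2 (λ { excess@(_ , enough) →
    excess₃-arithmetic n g (card W) (alive full W) large (girth₃ excess) enough (alive≤n full W) })

  opposite : Fin n → Edge → Fin n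
  opposite v e with v ≟ end₁ e
  ... | yes _ = end₂ e
  ... | no _  = end₁ e

  opposite-incident : ∀ v e → Incident (opposite v e) e
  opposite-incident v e with v ≟ end₁ e
  ... | yes _ = inj₂ refl
  ... | no _  = inj₁ refl

  opposite-≢ : ∀ v e → opposite v e ≢ v
  opposite-≢ v e with v ≟ end₁ e
  ... | yes p = λ q → noLoops G e (trans (sym p) (sym q))
  ... | no ¬p = ¬p ∘ sym

  opposite-inside : ∀ W {v e} → Incident v e → v ∈ W → opposite v e ∈ W → Inside W e
  opposite-inside W {v} {e} inc v∈W o∈W with v ≟ end₁ e | inc
  ... | yes refl | _        = v∈W , o∈W
  ... | no ¬p    | inj₁ p   = ⊥-elim (¬p p)
  ... | no ¬p    | inj₂ refl = o∈W , v∈W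

  opposite-distinct : ∀ {v e f} → e ≢ f → col e ≡ col f → Incident v e → Incident v f → opposite v e ≢ opposite v f
  opposite-distinct {v} {e} {f} e≢f same ve vf eq = no-parallel e≢f same (opposite-≢ v e ∘ sym) ve (opposite-incident v e) vf
    (subst (λ u → Incident u f) (sym eq) (opposite-incident v f))

  -- If no vertex set has positive excess, every vertex v is incident with all edges of a colour φ v of its own.
  module Dominated (A : Subset (m G)) (no-excess-A : ∀ W → alive A W ≤ card W)
    (pair : Fin n → Fin 2 → Edge) (pair∈A : ∀ c i → pair c i ∈ A)
    (pair-distinct : ∀ c → pair c zero ≢ pair c (suc zero)) (pair-colour : ∀ c i → col (pair c i) ≡ c) where

    -- Without positive excess at most n - 1 of the n colours are alive on the n - 1 vertices other
    -- than v.
    dominates : ∀ v → ∃ λ i → ¬ IsAlive A (full - v) i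
    dominates v with Fin.any? (λ i → ¬? (alive? A (full - v) i))
    ... | yes dead = dead
    ... | no ∄ = ⊥-elim (<⇒≱ (≤-trans (≤-reflexive (sym (card-remove full {v} refl))) (≤-trans (≤-reflexive (card-full n)) n≤alive))
            (no-excess-A (full - v)))
      where
      n≤alive : n ≤ alive A (full - v)
      n≤alive = ≤-trans (≤-reflexive (sym (trans (sum-const n 1) (*-identityʳ n))))
        (sum-mono (λ i → ≤-reflexive (sym (⟦⟧-yes (alive? A (full - v) i) (decidable-stable (alive? A (full - v) i) (λ d → ∄ (i , d)))))))

    φ : Fin n → Fin n
    φ v = proj₁ (dominates v)

    φ-incident : ∀ {v e} → e ∈ A → col e ≡ φ v → Incident v e
    φ-incident {v} {e} e∈A c with v ≟ end₁ e | v ≟ end₂ e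
    ... | yes p | _     = inj₁ p
    ... | no _  | yes q = inj₂ q
    ... | no p  | no q  = ⊥-elim (proj₂ (dominates v) (e , e∈A , c ,
            ∈-remove⁺ full {end₁ e} {v} refl (p ∘ sym) , ∈-remove⁺ full {end₂ e} {v} refl (q ∘ sym)))

    pair-incident : ∀ v i → Incident v (pair (φ v) i)
    pair-incident v i = φ-incident (pair∈A (φ v) i) (pair-colour (φ v) i)

    -- Two vertices with the same colour would both lie on both edges of its pair, making these
    -- edges parallel. This is why each colour must keep two edges in A.
    φ-injective : ∀ {u v} → φ u ≡ φ v → u ≡ v
    φ-injective {u} {v} eq = decidable-stable (u ≟ v) λ u≢v → no-parallel (pair-distinct (φ u))
      (trans (pair-colour _ _) (sym (pair-colour _ _))) u≢v (pair-incident u zero) (other zero)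
      (pair-incident u (suc zero)) (other (suc zero))
      where
      other : ∀ i → Incident v (pair (φ u) i)
      other i = φ-incident (pair∈A (φ u) i) (trans (pair-colour (φ u) i) eq)

    -- The colours `φ c` for c in C are distinct and alive in C, so C has excess zero.
    closed-bound : ∀ C → 1 ≤ card C → (∀ {c} → c ∈ C → ∃ λ e → e ∈ A × col e ≡ φ c × opposite c e ∈ C) → g ≤ card C
    closed-bound C 1≤ closed = girth₀ {A} (1≤ , ≤-trans (≤-reflexive (+-identityʳ _))
      (relation-count owns? C (comprehension (alive? A C)) (λ {c} c∈C → φ c , c∈C , refl) is-alive
        (λ p q → φ-injective (trans (proj₂ p) (sym (proj₂ q))))))
      where
      Owns : Fin n → Fin n → Set
      Owns c i = c ∈ C × φ c ≡ i
      owns? : ∀ c i → Dec (Owns c i)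
      owns? c i = (c ∈? C) ×-dec (φ c ≟ i)
      is-alive : ∀ {c i} → Owns c i → i ∈ comprehension (alive? A C)
      is-alive {c} {i} (c∈C , refl) with closed c∈C
      ... | e , e∈A , col≡ , o∈C = ∈-comp⁺ (alive? A C) {i} (e , e∈A , col≡ , opposite-inside C (φ-incident e∈A col≡) c∈C o∈C)

  no-excess₀⇒⊥ : (∀ W → alive full W ≤ card W) → ⊥
  no-excess₀⇒⊥ no-excess-full = ThreeOut.contradiction-from-large-girth out out-distinct (λ i v → opposite-≢ v _) g
    (λ C 1≤ closed → closed-bound C 1≤ (λ {c} c∈C → class (φ c) (proj₁ (closed c∈C)) , refl , class-colour (φ c) _ , proj₂ (closed c∈C)))
    large 1≤n
    where
    first-two : Fin 2 → Fin 3
    first-two zero       = zero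
    first-two (suc zero) = suc zero
    open Dominated full no-excess-full (λ c i → class c (first-two i)) (λ c i → refl)
      (λ c eq → case class-distinct c eq of λ ()) (λ c i → class-colour c (first-two i))
    out : Fin 3 → Fin n → Fin n
    out i v = opposite v (class (φ v) i)
    out-distinct : ∀ v {i j} → out i v ≡ out j v → i ≡ j
    out-distinct v {i} {j} eq = decidable-stable (i ≟ j) λ i≢j → opposite-distinct (i≢j ∘ class-distinct (φ v))
      (trans (class-colour (φ v) i) (sym (class-colour (φ v) j)))
      (φ-incident refl (class-colour (φ v) i)) (φ-incident refl (class-colour (φ v) j)) eq

  module Touching (W : Subset n) where

    -- Colours with two edges inside W keep all their edges. Thus every colour retains two edges in
    -- `A′`, and these few exceptional colours only add an error term to the counts.
    Touch : Edge → Set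
    Touch e = ¬ Inside W e ⊎ Multi full W (col e)

    touch? : ∀ e → Dec (Touch e)
    touch? e = ¬? (inside? W e) ⊎-dec multi? full W (col e)

    A′ : Subset (m G)
    A′ = comprehension touch?

    ∈A′⁺ : ∀ {e} → Touch e → e ∈ A′
    ∈A′⁺ {e} = ∈-comp⁺ touch? {e}

    ∈A′⁻ : ∀ {e} → e ∈ A′ → Touch e
    ∈A′⁻ {e} = ∈-comp⁻ touch? {e}

    -- A colour that is not exceptional has at most one of its three edges inside W.
    touching-pair : ∀ c → ∃ λ i → ∃ λ j → i ≢ j × Touch (class c i) × Touch (class c j)
    touching-pair c with multi? full W c
    ... | yes multi-c = zero , suc zero , (λ ()) , touches zero , touches (suc zero)
      where
      touches : ∀ i → Touch (class c i)
      touches i = inj₂ (subst (Multi full W) (sym (class-colour c i)) multi-c)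
    ... | no ¬multi = pick (inside? W (class c zero)) (inside? W (class c (suc zero)))
      where
      not-both : ∀ {i j} → i ≢ j → Inside W (class c i) → Touch (class c j)
      not-both {i} {j} i≢j in-i = inj₁ λ in-j → ¬multi (class c i , class c j , i≢j ∘ class-distinct c ,
        (refl , class-colour c i , in-i) , (refl , class-colour c j , in-j))
      pick : Dec (Inside W (class c zero)) → Dec (Inside W (class c (suc zero))) →
        ∃ λ i → ∃ λ j → i ≢ j × Touch (class c i) × Touch (class c j)
      pick (yes in₀) _        = suc zero , suc (suc zero) , (λ ()) , not-both (λ ()) in₀ , not-both (λ ()) in₀
      pick (no out₀) (yes in₁) = zero , suc (suc zero) , (λ ()) , inj₁ out₀ , not-both (λ ()) in₁
      pick (no out₀) (no out₁) = zero , suc zero , (λ ()) , inj₁ out₀ , inj₁ out₁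

    pair : Fin n → Fin 2 → Edge
    pair c zero       = class c (proj₁ (touching-pair c))
    pair c (suc zero) = class c (proj₁ (proj₂ (touching-pair c)))

    pair∈A′ : ∀ c i → pair c i ∈ A′
    pair∈A′ c zero       = ∈A′⁺ (proj₁ (proj₂ (proj₂ (proj₂ (touching-pair c)))))
    pair∈A′ c (suc zero) = ∈A′⁺ (proj₂ (proj₂ (proj₂ (proj₂ (touching-pair c)))))

    pair-distinct : ∀ c → pair c zero ≢ pair c (suc zero)
    pair-distinct c eq = proj₁ (proj₂ (proj₂ (touching-pair c))) (class-distinct c eq)

    pair-colour : ∀ c i → col (pair c i) ≡ c
    pair-colour c zero       = class-colour c _
    pair-colour c (suc zero) = class-colour c _

    excess-full′ : Excess A′ 0 full
    excess-full′ = excess-full A′ (λ c → pair c zero , pair∈A′ c zero , pair-colour c zero)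

    -- Since few edges of A′ lie inside W, about half of a critical set lies outside W.
    cover : ∀ k l {W′} → Critical A′ W′ → alive A′ W′ ≤ card W′ + k → multi full W ≤ l → card W′ ≤ 2 * card (W′ ∖ W) + (k + l)
    cover k l {W′} critical al≤ multi≤ = cover-arithmetic k l (card (W′ ∩ W)) (card (W′ ∖ W)) (card W′) (multi full W) (alive A′ W′)
      (touching-count (multi? full W) (W′ ∩ W) (λ v∈ → proj₁ (∈-∩⁻ W′ W v∈)) critical outside) al≤ multi≤ (card-split W′ W)
      where
      outside : ∀ e → e ∈ A′ → ¬ Multi full W (col e) → ¬ Inside (W′ ∩ W) e
      outside e e∈A′ ¬multi (u∈ , v∈) with ∈A′⁻ e∈A′
      ... | inj₁ ¬inside = ¬inside (proj₂ (∈-∩⁻ W′ W u∈) , proj₂ (∈-∩⁻ W′ W v∈))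
      ... | inj₂ multi-e = ¬multi multi-e

    complement-bound : ∀ W′ → card (W′ ∖ W) + card W ≤ n
    complement-bound W′ = card-disjoint (W′ ∖ W) W (λ v∈ → proj₂ (∈-∖⁻ W′ W v∈))

  -- A minimal W of excess two has at least 2g - 2 vertices and, since no set has excess three, at
  -- most four repeated colours. A minimal W′ of excess zero for `A′` has at least g vertices, and
  -- at least g/2 - 3 of them lie outside W. This exceeds n.
  alive≤+1 : ∀ W → alive full W ≤ card W + 1
  alive≤+1 W = no-excess full W 1 (minimal (Excess full 2) step W)
    where
    step : ∀ W → Excess full 2 W → (∀ W′ → card W′ < card W → ¬ Excess full 2 W′) → ⊥
    step W excess least = minimal (Excess A′ 0) step′ full excess-full′
      where
      open Touching W
      multi≤4 : multi full W ≤ 4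
      multi≤4 = multi-arithmetic 2 (card W) _ (alive full W) (multi-count (minimal⇒critical {e = 2} excess least)) (alive≤+2 W)
      step′ : ∀ W′ → Excess A′ 0 W′ → (∀ W″ → card W″ < card W′ → ¬ Excess A′ 0 W″) → ⊥
      step′ W′ excess′ least′ = excess₂-arithmetic n g (card W) (card W′) (card (W′ ∖ W)) large (girth₂ excess) (girth₀ excess′)
        (cover 2 4 (minimal⇒critical {e = 0} excess′ least′) (≤-trans (alive-mono W′ (λ _ → refl)) (alive≤+2 W′)) multi≤4)
        (complement-bound W′)

  -- A set of positive excess for `A′` would have 3g/2 vertices, about half of them outside W, which
  -- together with the 3g/2 of W is too much. Hence `Dominated` applies to `A′` and yields a digraph
  -- of outdegree two.
  module OneExcess (W : Subset n) (excess : Excess full 1 W) (least : ∀ W′ → card W′ < card W → ¬ Excess full 1 W′) where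
    open Touching W
    multi≤2 : multi full W ≤ 2
    multi≤2 = multi-arithmetic 1 (card W) _ (alive full W) (multi-count (minimal⇒critical {e = 1} excess least)) (alive≤+1 W)
    step′ : ∀ W′ → Excess A′ 1 W′ → (∀ W″ → card W″ < card W′ → ¬ Excess A′ 1 W″) → ⊥
    step′ W′ excess′ least′ = excess₁-arithmetic n g (card W) (card W′) (card (W′ ∖ W)) large (girth₁ excess) (girth₁ excess′)
      (cover 1 2 (minimal⇒critical {e = 1} excess′ least′) (≤-trans (alive-mono W′ (λ _ → refl)) (alive≤+1 W′)) multi≤2)
      (complement-bound W′)
    no-excess′ : ∀ V → alive A′ V ≤ card V
    no-excess′ V = ≤-trans (no-excess A′ V 0 (minimal (Excess A′ 1) step′ V)) (≤-reflexive (+-identityʳ _))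
    open Dominated A′ no-excess′ pair pair∈A′ pair-distinct pair-colour

    out : Fin 2 → Fin n → Fin n
    out i v = opposite v (pair (φ v) i)

    out-distinct : ∀ v → out zero v ≢ out (suc zero) v
    out-distinct v = opposite-distinct (pair-distinct (φ v)) (trans (pair-colour (φ v) zero) (sym (pair-colour (φ v) (suc zero))))
      (pair-incident v zero) (pair-incident v (suc zero))

    -- A vertex outside T lies in W, and its arcs follow edges that are not inside W, so both of
    -- them end in T. As `φ` is injective, the exceptional colours add at most two vertices to the
    -- complement of W.
    InT : Fin n → Set
    InT v = v ∉ W ⊎ Multi full W (φ v)

    inT? : ∀ v → Dec (InT v)
    inT? v = ¬? (v ∈? W) ⊎-dec multi? full W (φ v)

    T : Subset n
    T = comprehension inT?

    repeated : Subset n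
    repeated v = does (multi? full W (φ v))

    |T|≤ : card T ≤ card (full ∖ W) + 2
    |T|≤ = begin
      card T                                ≤⟨ card-mono T ((full ∖ W) ∪ repeated) (λ {v} v∈ → into {v} (∈-comp⁻ inT? {v} v∈)) ⟩
      card ((full ∖ W) ∪ repeated)          ≤⟨ card-∪ (full ∖ W) repeated ⟩
      card (full ∖ W) + card repeated       ≤⟨ +-monoʳ-≤ (card (full ∖ W)) (≤-trans |repeated|≤ multi≤2) ⟩
      card (full ∖ W) + 2                   ∎
      where
      open ≤-Reasoning
      into : ∀ {v} → InT v → v ∈ (full ∖ W) ∪ repeated
      into {v} (inj₁ v∉W) = ∈-∪⁺ˡ (full ∖ W) repeated {v} (∈-∖⁺ full W {v} refl v∉W)
      into {v} (inj₂ mul) = ∈-∪⁺ʳ (full ∖ W) repeated {v} (dec-true (multi? full W (φ v)) mul)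
      Owns : Fin n → Fin n → Set
      Owns v i = v ∈ repeated × φ v ≡ i
      |repeated|≤ : card repeated ≤ multi full W
      |repeated|≤ = relation-count {R = Owns} (λ v i → (v ∈? repeated) ×-dec (φ v ≟ i)) repeated (comprehension (multi? full W))
        (λ {v} v∈ → φ v , v∈ , refl) (λ { (v∈ , refl) → v∈ }) (λ p q → φ-injective (trans (proj₂ p) (sym (proj₂ q))))

    ∈T⁺ : ∀ {v} → InT v → v ∈ T
    ∈T⁺ {v} = ∈-comp⁺ inT? {v}

    out∈T : ∀ {v} i → v ∉ T → out i v ∈ T
    out∈T {v} i v∉T = ∈T⁺ (inj₁ λ o∈W → not-inside (∈A′⁻ (pair∈A′ (φ v) i)) (opposite-inside W (pair-incident v i) v∈W o∈W))
      where
      v∈W : v ∈ W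
      v∈W = decidable-stable (v ∈? W) (λ v∉W → v∉T (∈T⁺ (inj₁ v∉W)))
      not-inside : Touch (pair (φ v) i) → ¬ Inside W (pair (φ v) i)
      not-inside (inj₁ ¬inside) = ¬inside
      not-inside (inj₂ mul)     = ⊥-elim (v∉T (∈T⁺ (inj₂ (subst (Multi full W) (pair-colour (φ v) i) mul))))

    3g≤4|T| : 3 * g ≤ 2 * (2 * card T)
    3g≤4|T| = TwoOut.two-step-bound T out out-distinct out∈T g
      (λ C 1≤ closed → closed-bound C 1≤ (λ {c} c∈C → let i , o∈C = closed c∈C in
        pair (φ c) i , pair∈A′ (φ c) i , pair-colour (φ c) i , o∈C))
      (fromℕ< 1≤n)

  alive≤ : ∀ W → alive full W ≤ card W
  alive≤ W = ≤-trans (no-excess full W 0 (minimal (Excess full 1) step W)) (≤-reflexive (+-identityʳ _))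
    where
    step : ∀ W → Excess full 1 W → (∀ W′ → card W′ < card W → ¬ Excess full 1 W′) → ⊥
    step W excess least = two-out-arithmetic n g (card W) (card (full ∖ W)) (card T) large (girth₁ excess) 3g≤4|T| |T|≤ (complement-bound full)
      where
      open Touching W
      open OneExcess W excess least

  impossible : ⊥
  impossible = no-excess₀⇒⊥ alive≤

-- Finite search and the conclusion

any-vec? : ∀ {b p} a {P : Vec (Fin b) a → Set p} → (∀ v → Dec (P v)) → Dec (∃ P)
any-vec? zero    P? = map′ (Vec.[] ,_) (λ { (Vec.[] , p) → p }) (P? Vec.[])
any-vec? (suc a) P? = map′ (λ { (x , v , p) → x Vec.∷ v , p }) (λ { (x Vec.∷ v , p) → x , v , p })
  (Fin.any? λ x → any-vec? a (P? ∘ (x Vec.∷_)))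

injective? : ∀ {a b} (f : Fin a → Fin b) → Dec (∀ i j → f i ≡ f j → i ≡ j)
injective? f = Fin.all? λ i → Fin.all? λ j → (f i ≟ f j) →-dec (i ≟ j)

rainbow-cycle? : ∀ {n} (G : ColouredGraph n) k → Dec (RainbowCycle G k)
rainbow-cycle? {n} G k = map′ to from (any-vec? ℓ λ vs → any-vec? ℓ λ es →
    injective? (lookup vs) ×-dec Fin.all? (λ i → joins? (lookup es i) (lookup vs i) (lookup vs (next i))) ×-dec
    injective? (colour G ∘ lookup es))
  where
  ℓ : ℕ
  ℓ = suc (suc k)
  joins? : ∀ e u v → Dec (Joins G e u v)
  joins? e u v = ((proj₁ (endpoint G e) ≟ u) ×-dec (proj₂ (endpoint G e) ≟ v)) ⊎-dec
    ((proj₁ (endpoint G e) ≟ v) ×-dec (proj₂ (endpoint G e) ≟ u))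
  IsCycle : Vec (Fin n) ℓ → Vec (Fin (m G)) ℓ → Set
  IsCycle vs es = (∀ i j → lookup vs i ≡ lookup vs j → i ≡ j) ×
    (∀ i → Joins G (lookup es i) (lookup vs i) (lookup vs (next i))) ×
    (∀ i j → colour G (lookup es i) ≡ colour G (lookup es j) → i ≡ j)
  to : (∃ λ vs → ∃ λ es → IsCycle vs es) → RainbowCycle G k
  to (vs , es , inj , joins , rainbow) = record { vertex = lookup vs ; edge = lookup es
    ; vertexInj = inj _ _ ; joins = joins ; rainbow = rainbow _ _ }
  from : RainbowCycle G k → ∃ λ vs → ∃ λ es → IsCycle vs es
  from C = tabulate vertex , tabulate edge ,
    (λ i j eq → vertexInj (trans (sym (lookup∘tabulate vertex i)) (trans eq (lookup∘tabulate vertex j)))) ,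
    (λ i → subst₂ (Joins G (lookup (tabulate edge) i)) (sym (lookup∘tabulate vertex i)) (sym (lookup∘tabulate vertex (next i)))
      (subst (λ e → Joins G e (vertex i) (vertex (next i))) (sym (lookup∘tabulate edge i)) (joins i))) ,
    (λ i j eq → rainbow (trans (cong (colour G) (sym (lookup∘tabulate edge i)))
      (trans eq (cong (colour G) (lookup∘tabulate edge j)))))
    where open RainbowCycle C

-- The length bound also bounds k, which makes the search finite. Decidability is what turns the
-- refutation of large girth into an actual cycle.
short-cycle? : ∀ {n} (G : ColouredGraph n) b → Dec (∃ λ k → RainbowCycle G k × 9 * cycleLength k ≤ b)
short-cycle? G b = map′ (λ { (k , p) → toℕ k , p }) (λ { (k , C , le) → fromℕ< (bound le) ,
    subst (λ k → RainbowCycle G k × 9 * cycleLength k ≤ b) (sym (toℕ-fromℕ< (bound le))) (C , le) })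
  (Fin.any? λ (k : Fin b) → rainbow-cycle? G (toℕ k) ×-dec (9 * cycleLength (toℕ k) ≤? b))
  where
  bound : ∀ {k} → 9 * cycleLength k ≤ b → k < b
  bound {k} le = ≤-trans (n≤1+n (suc k)) (≤-trans (m≤n*m (cycleLength k) 9) le)

unique-lookup : ∀ {a} {A : Set a} {xs : List A} → Unique xs → ∀ i j → List.lookup xs i ≡ List.lookup xs j → i ≡ j
unique-lookup (_  AllPairs.∷ _) zero    zero    _  = refl
unique-lookup (x∉ AllPairs.∷ _) zero    (suc j) eq = ⊥-elim (ListAll.lookup x∉ (∈-lookup j) eq)
unique-lookup (x∉ AllPairs.∷ _) (suc i) zero    eq = ⊥-elim (ListAll.lookup x∉ (∈-lookup i) (sym eq))
unique-lookup (_  AllPairs.∷ u) (suc i) (suc j) eq = cong suc (unique-lookup u i j eq)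

theorem3p1 : (n : ℕ) → 1 ≤ n → (G : ColouredGraph n) → Simple G →
  (∀ (c : Fin n) → 3 ≤ classSize G c) →
  Σ ℕ (λ k → RainbowCycle G k × 9 * cycleLength k ≤ 4 * n + 63)
theorem3p1 n 1≤n G simple size = decidable-stable (short-cycle? G b) λ none →
  -- The bound g is the least integer above b / 9: cycles longer than allowed have length at least
  -- g, and 9g ≥ b + 1 = 4n + 64.
  LargeGirth.impossible G simple 1≤n (suc (b / 9)) (girth none) large class
    (λ c eq → inject≤-injective (size c) (size c) _ _ (unique-lookup (filter⁺ _ (allFin⁺ _)) _ _ eq))
    (λ c i → proj₂ (∈-filter⁻ (λ e → colour G e ≟ c) {xs = allFin (m G)} (∈-lookup (inject≤ i (size c)))))
  where
  b : ℕ
  b = 4 * n + 63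
  girth : ¬ (∃ λ k → RainbowCycle G k × 9 * cycleLength k ≤ b) → ∀ k → RainbowCycle G k → suc (b / 9) ≤ cycleLength k
  girth none k C = m<n*o⇒m/o<n (subst (b <_) (*-comm 9 (cycleLength k)) (≰⇒> λ le → none (k , C , le)))
  large : 4 * n + 64 ≤ 9 * suc (b / 9)
  large = begin
    4 * n + 64             ≡⟨ +-suc (4 * n) 63 ⟩
    suc b                  ≡⟨ cong suc (m≡m%n+[m/n]*n b 9) ⟩
    suc (b % 9) + b / 9 * 9 ≤⟨ +-monoˡ-≤ (b / 9 * 9) (m%n<n b 9) ⟩
    9 + b / 9 * 9          ≡⟨ *-comm (suc (b / 9)) 9 ⟩
    9 * suc (b / 9)        ∎
    where open ≤-Reasoning
  class : Fin n → Fin 3 → Fin (m G)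
  class c i = List.lookup (filter (λ e → colour G e ≟ c) (allFin (m G))) (inject≤ i (size c))
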